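{- Let $k \geq 2$ and $d \geq 2$ be fixed integers. There is a polynomial-time many-one reduction from VERTEX-COVER to $k$-VERTEX-STASH on $d$-uniform hypergraphs. That is, there is a polynomial-time computable map sending an instance $(G,s)$ of VERTEX-COVER (with $G$ a standard graph) to an instance $(G', s)$ with $G'$ a $d$-uniform hypergraph, such that $G$ has a vertex cover of size at most $s$ if and only if $G'$ has a $k$-vertex-stash of size at most $s$.
   Context: A $d$-uniform hypergraph (called "$d$-regular" in the paper) is a hypergraph in which every edge contains exactly $d$ vertices; $2$-uniform hypergraphs are standard graphs. The degree of a vertex is the number of edges containing it. The peeling process repeatedly removes a vertex of degree less than $k$ together with all edges containing it; the $k$-core is what remains (equivalently the maximal subhypergraph in which every vertex has degree at least $k$), and it does not depend on the order of removals. A hypergraph is $k$-peelable if its $k$-core is empty. A $k$-vertex-stash of a hypergraph $G$ is a set $V$ of vertices such that $G - V$ (removing the vertices of $V$ and all edges containing any of them) is $k$-peelable. For fixed $k,d$, the decision problem $k$-VERTEX-STASH$(G,s)$ asks whether the $d$-uniform hypergraph $G$ has a $k$-vertex-stash of size at most $s$. A vertex cover of a graph $G$ is a set of vertices meeting every edge; VERTEX-COVER$(G,s)$ asks whether $G$ has a vertex cover of size at most $s$. -}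

module Defs where

open import Data.Bool using (Bool; true; false)
open import Data.Digit using (toDigits)
open import Data.Fin using (Fin; zero; suc)
open import Data.Fin.Subset using (Subset; _∈_; _∩_; _─_; ⊤; ⁅_⁆; ∣_∣; Nonempty; Empty)
open import Data.Fin.Subset.Properties using (_∈?_; nonempty?)
open import Data.List using (List; []; _∷_; _++_; length; map; filter; concatMap; replicate)
open import Data.List.Relation.Unary.All using (All)
open import Data.List.Relation.Unary.Unique.Propositional using (Unique)
open import Data.Maybe using (Maybe; just; nothing)
import Data.Maybe as Maybe
open import Data.Nat using (ℕ; zero; suc; _+_; _*_; _^_; _≤_; _<_)
open import Data.Product using (∃-syntax; _×_; _,_; proj₁; proj₂)
open import Data.Vec using (Vec; []; _∷_; toList; zipWith)
import Data.Vec as Vec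
open import Function.Bundles using (_↔_; _⇔_)
open import Relation.Binary.Construct.Closure.ReflexiveTransitive using (Star)
open import Relation.Binary.PropositionalEquality using (_≡_)
open import Relation.Nullary.Decidable using (¬?)

-- The edge set is a duplicate-free list of vertex sets, so that it can be
-- written on a tape; no definition below depends on the order of the list
-- except the encoding itself.
record Hypergraph (d : ℕ) : Set where
  field
    order   : ℕ
    edges   : List (Subset order)
    uniform : All (λ e → ∣ e ∣ ≡ d) edges
    simple  : Unique edges

open Hypergraph public

-- A hypergraph whose vertex set is only part of Fin n.
record Residual (n : ℕ) : Set where
  constructor residual
  field
    vertices   : Subset n
    hyperedges : List (Subset n)

open Residual public

whole : ∀ {d} (G : Hypergraph d) → Residual (order G)
whole G = residual ⊤ (edges G)

infixl 6 _∖_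
_∖_ : ∀ {n} → Residual n → Subset n → Residual n
residual S E ∖ V = residual (S ─ V) (filter (λ e → ¬? (nonempty? (e ∩ V))) E)

degree : ∀ {n} → Residual n → Fin n → ℕ
degree H v = length (filter (v ∈?_) (hyperedges H))

data Peel (k : ℕ) {n : ℕ} (H : Residual n) : Residual n → Set where
  peel : ∀ v → v ∈ vertices H → degree H v < k → Peel k H (H ∖ ⁅ v ⁆)

IsCore : ∀ {n} → ℕ → Residual n → Residual n → Set
IsCore k H C = Star (Peel k) H C × (∀ v → v ∈ vertices C → k ≤ degree C v)

Peelable : ∀ {n} → ℕ → Residual n → Set
Peelable k H = ∃[ C ] (IsCore k H C × Empty (vertices C))

IsVertexStash : ∀ {d} → ℕ → (G : Hypergraph d) → Subset (order G) → Set
IsVertexStash k G V = Peelable k (whole G ∖ V)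

IsVertexCover : (G : Hypergraph 2) → Subset (order G) → Set
IsVertexCover G V = All (λ e → Nonempty (e ∩ V)) (edges G)

Instance : ℕ → Set
Instance d = Hypergraph d × ℕ

VERTEX-COVER : Instance 2 → Set
VERTEX-COVER (G , s) = ∃[ V ] (IsVertexCover G V × ∣ V ∣ ≤ s)

VERTEX-STASH : (k : ℕ) {d : ℕ} → Instance d → Set
VERTEX-STASH k (G , s) = ∃[ V ] (IsVertexStash k G V × ∣ V ∣ ≤ s)

data Symbol : Set where
  𝟘 𝟙 ♯ : Symbol

bit : Bool → Symbol
bit false = 𝟘
bit true  = 𝟙

binaryDigit : Fin 2 → Symbol
binaryDigit zero       = 𝟘
binaryDigit (suc zero) = 𝟙

-- (G , s) is written as  s ♯ 1ⁿ ♯ r₁ ♯ r₂ … ♯ rₘ, where s is in binary (least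
-- significant digit first), n is the number of vertices and r₁, …, rₘ are
-- the rows of the edge-vertex incidence matrix.
encode : ∀ {d} → Instance d → List Symbol
encode (G , s) =
  map binaryDigit (proj₁ (toDigits 2 s))
  ++ ♯ ∷ replicate (order G) 𝟙
  ++ concatMap (λ e → ♯ ∷ map bit (toList e)) (edges G)

data Cell (marks : ℕ) : Set where
  blank : Cell marks
  sym   : Symbol → Cell marks
  mark  : Fin marks → Cell marks

-- Two-way infinite; `left` and `right` are listed outwards from the head and
-- every cell beyond them is blank.
record Tape (marks : ℕ) : Set where
  constructor tape
  field
    left  : List (Cell marks)
    head  : Cell marks
    right : List (Cell marks)

data Move : Set where
  goLeft stay goRight : Move

module _ {marks : ℕ} where

  move : Move → Tape marks → Tape marks
  move goLeft  (tape []       h rs)       = tape [] blank (h ∷ rs)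
  move goLeft  (tape (l ∷ ls) h rs)       = tape ls l (h ∷ rs)
  move stay    t                          = t
  move goRight (tape ls       h [])       = tape (h ∷ ls) blank []
  move goRight (tape ls       h (r ∷ rs)) = tape (h ∷ ls) r rs

  act : Cell marks × Move → Tape marks → Tape marks
  act (c , m) (tape ls _ rs) = move m (tape ls c rs)

  blankTape : Tape marks
  blankTape = tape [] blank []

  inputTape : List Symbol → Tape marks
  inputTape []       = blankTape
  inputTape (a ∷ as) = tape [] (sym a) (map sym as)

  symbolPrefix : List (Cell marks) → List Symbol
  symbolPrefix (sym a ∷ cs) = a ∷ symbolPrefix cs
  symbolPrefix _            = []

  -- The string that starts under the head and ends before the first cell
  -- not holding an input symbol.
  contents : Tape marks → List Symbol
  contents (tape _ h rs) = symbolPrefix (h ∷ rs)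

-- Tape 0 is the input tape, tape 1 the output tape; all tapes are
-- read-write. The machine halts when δ returns `nothing`.
record TuringMachine : Set₁ where
  field
    work     : ℕ
    marks    : ℕ
    State    : Set
    finite   : ∃[ q ] (State ↔ Fin q)
    start    : State
    δ        : State → Vec (Cell marks) (2 + work) →
               Maybe (State × Vec (Cell marks × Move) (2 + work))

  Config : Set
  Config = State × Vec (Tape marks) (2 + work)

  step : Config → Maybe Config
  step (q , ts) =
    Maybe.map (λ (q′ , as) → q′ , zipWith act as ts) (δ q (Vec.map Tape.head ts))

  initial : List Symbol → Config
  initial w = start , inputTape w ∷ Vec.replicate _ blankTape

  output : Config → List Symbol
  output (_ , _ ∷ t ∷ _) = contents t

  data _⇓[_]_ (c : Config) : ℕ → Config → Set where
    halt : step c ≡ nothing → c ⇓[ 0 ] c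
    next : ∀ {c′ c″ t} → step c ≡ just c′ → c′ ⇓[ t ] c″ → c ⇓[ suc t ] c″

record PolyTime {A B : Set} (encA : A → List Symbol) (encB : B → List Symbol)
                (f : A → B) : Set₁ where
  field
    machine : TuringMachine
  open TuringMachine machine
  field
    factor exponent : ℕ
    computes : ∀ x → ∃[ t ] ∃[ c ]
      ( (initial (encA x) ⇓[ t ] c)
      × output c ≡ encB (f x)
      × t ≤ factor * length (encA x) ^ exponent + factor )

record IsPolyTimeReduction {d d′ : ℕ} (P : Instance d → Set) (Q : Instance d′ → Set)
                           (f : Instance d → Instance d′) : Set₁ where
  field
    polyTime : PolyTime encode encode f
    correct  : ∀ I → P I ⇔ Q (f I)

{-# OPTIONS --safe #-}

-- Each edge {u, v} of G is replaced by a copy of one fixed gadget: the complete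
-- graph on k + 1 vertices u, v, w₁, …, wₖ₋₁, all of whose edges are enlarged by
-- the same d - 2 padding vertices; the wⱼ and the padding are private to the
-- copy. All degrees in an intact copy are at least k, so a copy that a stash
-- does not touch survives peeling, and moving every private vertex of a stash to
-- an end of its edge gives a vertex cover. Conversely wⱼ has degree exactly k,
-- so once u or v is removed all wⱼ can be peeled, and no edge of the copy is left.
--
-- A row of the new incidence matrix is a row of G with some ones erased, followed
-- by one block of k + d - 3 bits per edge of G, all but one of them zero. A machine
-- with a unary edge counter on its work tape writes it in one pass over the
-- row of G and one over the counter, which gives quadratic time.

module Submission where

open import Defs
open import Data.Bool using (Bool; true; false; not; _∨_; if_then_else_)
open import Data.Digit using (toDigits)
open import Data.Fin using (Fin; zero; suc; toℕ; _↑ˡ_; _↑ʳ_; splitAt; punchIn; punchOut; quotient)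
open import Data.Fin.Patterns using (0F; 1F; 2F)
open import Data.Fin.Properties
  using (+↔⊎; any?; _≟_; suc-injective; punchIn-punchOut; splitAt-↑ˡ; splitAt-↑ʳ; splitAt⁻¹-↑ˡ; splitAt⁻¹-↑ʳ)
open import Data.Fin.Subset as Subset
  using (Subset; inside; outside; ∣_∣; ⁅_⁆; ⊤; ⊥; _∈_; _∉_; _⊆_; _∪_; _∩_; _─_; Nonempty)
open import Data.Fin.Subset.Properties
open import Data.List as List using (List; []; _∷_; _++_; _ʳ++_; length; reverse)
import Data.List.Membership.Propositional as List
import Data.List.Membership.Propositional.Properties as List
import Data.List.Properties as List
open import Data.List.Relation.Unary.All as All using (All; []; _∷_)
import Data.List.Relation.Unary.All.Properties as All
open import Data.List.Relation.Unary.AllPairs using ([]; _∷_)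
open import Data.List.Relation.Unary.Any as Any using (here; there)
import Data.List.Relation.Unary.Any.Properties as Any
open import Data.List.Relation.Unary.Unique.Propositional using (Unique)
import Data.List.Relation.Unary.Unique.Propositional.Properties as Unique
open import Data.Maybe as Maybe using (Maybe; just; nothing)
open import Data.Nat
  using (ℕ; zero; suc; _+_; _*_; _∸_; _^_; _⊔_; _≤_; _<_; _<?_; z≤n; s≤s; NonZero; >-nonZero)
open import Data.Nat.Induction using (<-wellFounded)
open import Data.Nat.Properties as ℕ
  using (≤-refl; ≤-reflexive; ≤-trans; +-assoc; +-suc; +-identityʳ; +-mono-≤; +-monoʳ-≤;
         *-identityˡ; *-identityʳ; *-distribʳ-+; *-mono-≤; *-monoˡ-≤; *-monoʳ-≤; ^-monoʳ-≤; ^-distribˡ-+-*;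
         [m*n]*[o*p]≡[m*o]*[n*p]; m≤m+n; m≤n+m; n≤1+n; m≤m⊔n; m≤n⊔m; ≡-irrelevant)
open import Data.Product using (∃-syntax; _×_; _,_; proj₁; proj₂; map₁)
open import Data.Sum using (_⊎_; inj₁; inj₂)
open import Data.Sum.Function.Propositional using (_⊎-↔_)
open import Data.Vec as Vec using (Vec; []; _∷_; lookup; here; there; zipWith; _[_]≔_)
import Data.Vec.Properties as Vec
open import Function using (_∘_; id; _↔_; _⇔_; mk⇔)
open import Function.Construct.Composition using (_↔-∘_)
open import Function.Construct.Identity using (↔-id)
open import Function.Construct.Symmetry using (↔-sym)
open import Induction.WellFounded using (Acc; acc)
open import Relation.Binary.Construct.Closure.ReflexiveTransitive using (Star; ε; _◅_)
open import Relation.Binary.PropositionalEquality as ≡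
  using (_≡_; _≢_; refl; trans; cong; cong₂; subst; subst₂)
open import Relation.Nullary using (¬_; yes; no; contradiction)
open import Relation.Nullary.Decidable using (_×-dec_)

-- Subsets

-- The clique has `k + 1` vertices so that each wⱼ sits exactly at the threshold: degree `k`
-- withstands peeling, and the loss of the one edge to a removed end leaves `k - 1`. The padding is
-- shared by all edges of a copy so that its vertices lie on every one of them; padding private to a
-- single clique edge would have degree 1 and be peeled at once, since `2 ≤ k`.
--
-- No order of removals is constructed. Some core always exists, and every residual that occurs is
-- induced by its vertex set, so its edges are known once its vertices are; both directions then
-- only compare degrees in such residuals.
--
-- The gadget depends on `k` and `d` alone. Its list of edges is therefore part of the finite
-- control of the machine, and each row of `G` is read a constant number of times.

expand : ∀ {m n} → Vec Bool m → Subset n → Subset n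
expand q       []          = []
expand q       (false ∷ e) = false ∷ expand q e
expand []      (true ∷ e)  = false ∷ expand [] e
expand (x ∷ q) (true ∷ e)  = x ∷ expand q e

-- The increasing enumeration of `e`. For `e` of size `m`, `expand q e` is the image of `q` under
-- it; this is how a gadget edge is placed on the vertices of one copy.
pos : ∀ {m n} (e : Subset n) → ∣ e ∣ ≡ m → Fin m → Fin n
pos []          refl ()
pos (true ∷ e)  eq   zero    = zero
pos (true ∷ e)  eq   (suc x) = suc (pos e (ℕ.suc-injective eq) x)
pos (false ∷ e) eq   x       = suc (pos e eq x)

pos-injective : ∀ {m n} (e : Subset n) (eq : ∣ e ∣ ≡ m) {x y} → pos e eq x ≡ pos e eq y → x ≡ y
pos-injective []          refl {()}
pos-injective (true ∷ e)  eq {zero}  {zero}  _ = refl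
pos-injective (true ∷ e)  eq {suc x} {suc y} h = cong suc (pos-injective e _ (suc-injective h))
pos-injective (false ∷ e) eq                 h = pos-injective e eq (suc-injective h)

lookup-expand : ∀ {m n} (q : Vec Bool m) (e : Subset n) (eq : ∣ e ∣ ≡ m) x →
                lookup (expand q e) (pos e eq x) ≡ lookup q x
lookup-expand q       []          refl ()
lookup-expand (_ ∷ q) (true ∷ e)  eq zero    = refl
lookup-expand (_ ∷ q) (true ∷ e)  eq (suc x) = lookup-expand q e _ x
lookup-expand q       (false ∷ e) eq x       = lookup-expand q e eq x

expand-⊆ : ∀ {m n} (q : Vec Bool m) (e : Subset n) → expand q e ⊆ e
expand-⊆ []      (true ∷ e)  (there a∈) = there (expand-⊆ [] e a∈)
expand-⊆ (_ ∷ q) (true ∷ e)  here       = here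
expand-⊆ (_ ∷ q) (true ∷ e)  (there a∈) = there (expand-⊆ q e a∈)
expand-⊆ q       (false ∷ e) (there a∈) = there (expand-⊆ q e a∈)

pos-surjective : ∀ {m n} (e : Subset n) (eq : ∣ e ∣ ≡ m) {a} → a ∈ e → ∃[ x ] a ≡ pos e eq x
pos-surjective {suc m} (true ∷ e) eq here = zero , refl
pos-surjective {suc m} (true ∷ e) eq (there a∈) with pos-surjective e (ℕ.suc-injective eq) a∈
... | x , refl = suc x , refl
pos-surjective (false ∷ e) eq (there a∈) with pos-surjective e eq a∈
... | x , refl = x , refl

pos-∈ : ∀ {m n} (e : Subset n) (eq : ∣ e ∣ ≡ m) x → pos e eq x ∈ e
pos-∈ []          refl ()
pos-∈ (true ∷ e)  eq zero    = here
pos-∈ (true ∷ e)  eq (suc x) = there (pos-∈ e _ x)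
pos-∈ (false ∷ e) eq x       = there (pos-∈ e eq x)

pos-expand⁺ : ∀ {m n} (q : Subset m) (e : Subset n) (eq : ∣ e ∣ ≡ m) {x} → x ∈ q → pos e eq x ∈ expand q e
pos-expand⁺ q e eq {x} x∈q =
  Vec.lookup⇒[]= _ (expand q e) (trans (lookup-expand q e eq x) (Vec.[]=⇒lookup x∈q))

pos-expand⁻ : ∀ {m n} (q : Subset m) (e : Subset n) (eq : ∣ e ∣ ≡ m) {x} → pos e eq x ∈ expand q e → x ∈ q
pos-expand⁻ q e eq {x} a∈ =
  Vec.lookup⇒[]= x q (trans (≡.sym (lookup-expand q e eq x)) (Vec.[]=⇒lookup a∈))

expand-injective : ∀ {m n} (e : Subset n) → ∣ e ∣ ≡ m → {q q′ : Subset m} → expand q e ≡ expand q′ e → q ≡ q′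
expand-injective e eq {q} {q′} h = ⊆-antisym (half h) (half (≡.sym h))
  where
  half : ∀ {q q′} → expand q e ≡ expand q′ e → q ⊆ q′
  half {q} {q′} h x∈q = pos-expand⁻ q′ e eq (subst (_ ∈_) h (pos-expand⁺ q e eq x∈q))

∣expand∣ : ∀ {m n} (q : Subset m) (e : Subset n) → ∣ e ∣ ≡ m → ∣ expand q e ∣ ≡ ∣ q ∣
∣expand∣ []          []          refl = refl
∣expand∣ (true ∷ q)  (true ∷ e)  eq   = cong suc (∣expand∣ q e (ℕ.suc-injective eq))
∣expand∣ (false ∷ q) (true ∷ e)  eq   = ∣expand∣ q e (ℕ.suc-injective eq)
∣expand∣ q           (false ∷ e) eq   = ∣expand∣ q e eq

expand-⊤ : ∀ {m n} (e : Subset n) → ∣ e ∣ ≡ m → expand (⊤ {m}) e ≡ e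
expand-⊤ []          refl = refl
expand-⊤ {suc m} (true ∷ e) eq = cong (true ∷_) (expand-⊤ e (ℕ.suc-injective eq))
expand-⊤ {m} (false ∷ e) eq = cong (false ∷_) (expand-⊤ e eq)

expand-full : ∀ {m} (q : Subset m) → expand q (⊤ {m}) ≡ q
expand-full []      = refl
expand-full (x ∷ q) = cong (x ∷_) (expand-full q)

expand-⊥ : ∀ {m} (q : Subset m) n → expand q (⊥ {n}) ≡ ⊥
expand-⊥ q zero    = refl
expand-⊥ q (suc n) = cong (false ∷_) (expand-⊥ q n)

expand-++ : ∀ {m m′ n n′} (q : Subset m) (p : Subset m′) (e : Subset n) (f : Subset n′) → ∣ e ∣ ≡ m →
            expand (q Vec.++ p) (e Vec.++ f) ≡ expand q e Vec.++ expand p f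
expand-++ []      p []          f refl = refl
expand-++ (x ∷ q) p (true ∷ e)  f eq = cong (x ∷_) (expand-++ q p e f (ℕ.suc-injective eq))
expand-++ []      p (false ∷ e) f eq = cong (false ∷_) (expand-++ [] p e f eq)
expand-++ (x ∷ q) p (false ∷ e) f eq = cong (false ∷_) (expand-++ (x ∷ q) p e f eq)

∣++∣ : ∀ {m n} (p : Subset m) (q : Subset n) → ∣ p Vec.++ q ∣ ≡ ∣ p ∣ + ∣ q ∣
∣++∣ []          q = refl
∣++∣ (true ∷ p)  q = cong suc (∣++∣ p q)
∣++∣ (false ∷ p) q = ∣++∣ p q

pos-++ˡ : ∀ {m m′ n n′} (e : Subset n) (f : Subset n′) (eq : ∣ e ∣ ≡ m) (eq′ : ∣ e Vec.++ f ∣ ≡ m + m′) x →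
          pos (e Vec.++ f) eq′ (x ↑ˡ m′) ≡ pos e eq x ↑ˡ n′
pos-++ˡ []          f refl eq′ ()
pos-++ˡ (true ∷ e)  f eq eq′ zero    = refl
pos-++ˡ (true ∷ e)  f eq eq′ (suc x) = cong suc (pos-++ˡ e f _ _ x)
pos-++ˡ (false ∷ e) f eq eq′ x       = cong suc (pos-++ˡ e f _ _ x)

pos-++ʳ : ∀ {m m′ n n′} (e : Subset n) (f : Subset n′) (eq : ∣ e ∣ ≡ m) (eq′ : ∣ f ∣ ≡ m′)
          (eq″ : ∣ e Vec.++ f ∣ ≡ m + m′) x → pos (e Vec.++ f) eq″ (m ↑ʳ x) ≡ n ↑ʳ pos f eq′ x
pos-++ʳ []          f refl eq′ eq″ x = cong (λ eq → pos f eq x) (≡-irrelevant eq″ eq′)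
pos-++ʳ {suc m} (true ∷ e)  f eq eq′ eq″ x = cong suc (pos-++ʳ e f (ℕ.suc-injective eq) eq′ _ x)
pos-++ʳ (false ∷ e) f eq eq′ eq″ x = cong suc (pos-++ʳ e f eq eq′ eq″ x)

-- Disjoint blocks of coordinates

block : ∀ {m c} → Fin m → Subset c → Subset (m * c)
block {suc m} {c} zero    p = p Vec.++ ⊥
block {suc m} {c} (suc i) p = ⊥ {c} Vec.++ block i p

∣++⊥∣ : ∀ {m n} (p : Subset m) → ∣ p Vec.++ ⊥ {n} ∣ ≡ ∣ p ∣
∣++⊥∣ {n = n} p = trans (∣++∣ p ⊥) (trans (cong (∣ p ∣ +_) (∣⊥∣≡0 n)) (+-identityʳ ∣ p ∣))

∣block∣ : ∀ {m c} (i : Fin m) (p : Subset c) → ∣ block i p ∣ ≡ ∣ p ∣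
∣block∣         zero    p = ∣++⊥∣ p
∣block∣ {c = c} (suc i) p = trans (∣++∣ (⊥ {c}) (block i p)) (cong₂ _+_ (∣⊥∣≡0 c) (∣block∣ i p))

expand-⊥++ : ∀ {m n n′} (q : Subset m) (f : Subset n′) → expand q (⊥ {n} Vec.++ f) ≡ ⊥ {n} Vec.++ expand q f
expand-⊥++ {n = zero}  q f = refl
expand-⊥++ {n = suc n} q f = cong (false ∷_) (expand-⊥++ q f)

expand-++⊥ : ∀ {m n n′} (q : Subset m) (e : Subset n) → expand q (e Vec.++ ⊥ {n′}) ≡ expand q e Vec.++ ⊥
expand-++⊥ q       []          = expand-⊥ q _
expand-++⊥ []      (true ∷ e)  = cong (false ∷_) (expand-++⊥ [] e)
expand-++⊥ (x ∷ q) (true ∷ e)  = cong (x ∷_) (expand-++⊥ q e)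
expand-++⊥ q       (false ∷ e) = cong (false ∷_) (expand-++⊥ q e)

expand-block : ∀ {m c} (i : Fin m) (p : Subset c) → expand p (block i ⊤) ≡ block i p
expand-block {suc m} {c} zero    p = trans (expand-++⊥ p (⊤ {c})) (cong (Vec._++ ⊥) (expand-full p))
expand-block {suc m} {c} (suc i) p = trans (expand-⊥++ {n = c} p (block i ⊤)) (cong (⊥ {c} Vec.++_) (expand-block i p))

∈-++⁻ : ∀ {m n} (p : Subset m) (q : Subset n) {a} → a ∈ p Vec.++ q →
        (∃[ b ] a ≡ b ↑ˡ n) ⊎ (∃[ b ] (b ∈ q × a ≡ m ↑ʳ b))
∈-++⁻ []      q a∈         = inj₂ (_ , a∈ , refl)
∈-++⁻ (_ ∷ p) q here       = inj₁ (zero , refl)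
∈-++⁻ (_ ∷ p) q (there a∈) with ∈-++⁻ p q a∈
... | inj₁ (b , refl)      = inj₁ (suc b , refl)
... | inj₂ (b , b∈ , refl) = inj₂ (b , b∈ , refl)

∈-++⁺ˡ : ∀ {m n} {p : Subset m} {q : Subset n} {a} → a ∈ p → a ↑ˡ n ∈ p Vec.++ q
∈-++⁺ˡ here       = here
∈-++⁺ˡ (there a∈) = there (∈-++⁺ˡ a∈)

∈-++⁻ˡ : ∀ {m n} (p : Subset m) {q : Subset n} {a} → a ↑ˡ n ∈ p Vec.++ q → a ∈ p
∈-++⁻ˡ (_ ∷ p) {a = zero}  here       = here
∈-++⁻ˡ (_ ∷ p) {a = suc a} (there a∈) = there (∈-++⁻ˡ p a∈)

∈-++⁺ʳ : ∀ {m n} (p : Subset m) {q : Subset n} {a} → a ∈ q → m ↑ʳ a ∈ p Vec.++ q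
∈-++⁺ʳ []      a∈ = a∈
∈-++⁺ʳ (_ ∷ p) a∈ = there (∈-++⁺ʳ p a∈)

∈-++⁻ʳ : ∀ {m n} (p : Subset m) {q : Subset n} {a} → m ↑ʳ a ∈ p Vec.++ q → a ∈ q
∈-++⁻ʳ []      a∈         = a∈
∈-++⁻ʳ (_ ∷ p) (there a∈) = ∈-++⁻ʳ p a∈

-- This is what makes private vertices private: the copy can be read off the vertex.
quotient-block : ∀ {m c} (i : Fin m) {p : Subset c} {a} → a ∈ block i p → quotient c a ≡ i
quotient-block {suc m} {c} zero {p} a∈ with ∈-++⁻ p ⊥ a∈
... | inj₁ (b , refl) rewrite splitAt-↑ˡ c b (m * c) = refl
... | inj₂ (_ , b∈ , _) = contradiction b∈ ∉⊥
quotient-block {suc m} {c} (suc i) {p} a∈ with ∈-++⁻ (⊥ {c}) (block i p) a∈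
... | inj₁ (b , refl) = contradiction (∈-++⁻ˡ (⊥ {c}) a∈) ∉⊥
... | inj₂ (b , b∈ , refl) rewrite splitAt-↑ʳ c (m * c) b = cong suc (quotient-block i b∈)

-- Sets of given size and pairs through a given vertex

combos : ℕ → ∀ n → List (Subset n)
combos zero    zero    = [] ∷ []
combos (suc j) zero    = []
combos zero    (suc n) = List.map (outside ∷_) (combos zero n)
combos (suc j) (suc n) = List.map (inside ∷_) (combos j n) ++ List.map (outside ∷_) (combos (suc j) n)

∈-combos⁺ : ∀ {j n} (p : Subset n) → ∣ p ∣ ≡ j → p List.∈ combos j n
∈-combos⁺ {zero}  []          eq = here refl
∈-combos⁺ {zero}  (false ∷ p) eq = List.∈-map⁺ _ (∈-combos⁺ p eq)
∈-combos⁺ {suc j} (false ∷ p) eq = List.∈-++⁺ʳ _ (List.∈-map⁺ _ (∈-combos⁺ p eq))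
∈-combos⁺ {suc j} (true ∷ p)  eq = List.∈-++⁺ˡ (List.∈-map⁺ _ (∈-combos⁺ p (ℕ.suc-injective eq)))

∈-combos⁻ : ∀ j {n} {p : Subset n} → p List.∈ combos j n → ∣ p ∣ ≡ j
∈-combos⁻ zero    {zero}  (here refl) = refl
∈-combos⁻ zero    {suc n} p∈ with List.∈-map⁻ _ p∈
... | _ , q∈ , refl = ∈-combos⁻ zero q∈
∈-combos⁻ (suc j) {suc n} p∈ with List.∈-++⁻ (List.map (inside ∷_) (combos j n)) p∈
... | inj₁ p∈ˡ with List.∈-map⁻ _ p∈ˡ
...   | _ , q∈ , refl = cong suc (∈-combos⁻ j q∈)
∈-combos⁻ (suc j) {suc n} p∈ | inj₂ p∈ʳ with List.∈-map⁻ _ p∈ʳ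
...   | _ , q∈ , refl = ∈-combos⁻ (suc j) q∈

combos-unique : ∀ j n → Unique (combos j n)
combos-unique zero    zero    = [] ∷ []
combos-unique (suc j) zero    = []
combos-unique zero    (suc n) = Unique.map⁺ Vec.∷-injectiveʳ (combos-unique zero n)
combos-unique (suc j) (suc n) = Unique.++⁺
  (Unique.map⁺ Vec.∷-injectiveʳ (combos-unique j n))
  (Unique.map⁺ Vec.∷-injectiveʳ (combos-unique (suc j) n))
  λ (p∈ , p∈′) → disjoint (List.∈-map⁻ _ p∈) (List.∈-map⁻ _ p∈′)
  where
  disjoint : ∀ {p : Subset (suc n)} {P R : Subset n → Set} →
             ∃[ q ] (P q × p ≡ inside ∷ q) → ¬ (∃[ q ] (R q × p ≡ outside ∷ q))
  disjoint (_ , _ , refl) (_ , _ , ())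

-- The pair of `x` and `punchIn x y`. Numbering the partner among the vertices other than `x` makes
-- `couple x` a bijection onto the pairs through `x`, so the degree of a clique vertex is the size
-- of the index type.
couple : ∀ {n} → Fin (suc n) → Fin n → Subset (suc n)
couple         zero    y       = inside ∷ ⁅ y ⁆
couple {suc n} (suc x) zero    = inside ∷ ⁅ x ⁆
couple {suc n} (suc x) (suc y) = outside ∷ couple x y

∣couple∣ : ∀ {n} (x : Fin (suc n)) y → ∣ couple x y ∣ ≡ 2
∣couple∣         zero    y       = cong suc (∣⁅x⁆∣≡1 y)
∣couple∣ {suc n} (suc x) zero    = cong suc (∣⁅x⁆∣≡1 x)
∣couple∣ {suc n} (suc x) (suc y) = ∣couple∣ x y

∈-couple : ∀ {n} (x : Fin (suc n)) y → x ∈ couple x y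
∈-couple         zero    y       = here
∈-couple {suc n} (suc x) zero    = there (x∈⁅x⁆ x)
∈-couple {suc n} (suc x) (suc y) = there (∈-couple x y)

∈-couple-punchOut : ∀ {n} {x z : Fin (suc n)} (x≢z : x ≢ z) → z ∈ couple x (punchOut x≢z)
∈-couple-punchOut         {x = zero}  {zero}  x≢z = contradiction refl x≢z
∈-couple-punchOut         {x = zero}  {suc z} x≢z = there (x∈⁅x⁆ z)
∈-couple-punchOut {suc n} {x = suc x} {zero}  x≢z = here
∈-couple-punchOut {suc n} {x = suc x} {suc z} x≢z = there (∈-couple-punchOut (x≢z ∘ cong suc))

⁅⁆-injective : ∀ {n} {x y : Fin n} → ⁅ x ⁆ ≡ ⁅ y ⁆ → x ≡ y
⁅⁆-injective {x = x} {y} eq = x∈⁅y⁆⇒x≡y y (subst (x ∈_) eq (x∈⁅x⁆ x))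

couple-injective : ∀ {n} (x : Fin (suc n)) {y z} → couple x y ≡ couple x z → y ≡ z
couple-injective         zero                    eq = ⁅⁆-injective (Vec.∷-injectiveʳ eq)
couple-injective {suc n} (suc x) {zero}  {zero}  eq = refl
couple-injective {suc n} (suc x) {suc y} {suc z} eq = cong suc (couple-injective x (Vec.∷-injectiveʳ eq))

∣p∣≡0⇒p≡⊥ : ∀ {n} (p : Subset n) → ∣ p ∣ ≡ 0 → p ≡ ⊥
∣p∣≡0⇒p≡⊥ []          _  = refl
∣p∣≡0⇒p≡⊥ (false ∷ p) eq = cong (false ∷_) (∣p∣≡0⇒p≡⊥ p eq)

∣p∣≡1⇒p≡⁅x⁆ : ∀ {n} (p : Subset n) → ∣ p ∣ ≡ 1 → ∃[ x ] p ≡ ⁅ x ⁆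
∣p∣≡1⇒p≡⁅x⁆ (true ∷ p)  eq = zero , cong (true ∷_) (∣p∣≡0⇒p≡⊥ p (ℕ.suc-injective eq))
∣p∣≡1⇒p≡⁅x⁆ (false ∷ p) eq with ∣p∣≡1⇒p≡⁅x⁆ p eq
... | x , refl = suc x , refl

couple-surjective : ∀ {n} (p : Subset (suc n)) {x} → ∣ p ∣ ≡ 2 → x ∈ p → ∃[ y ] p ≡ couple x y
couple-surjective (true ∷ p) {zero} eq here with ∣p∣≡1⇒p≡⁅x⁆ p (ℕ.suc-injective eq)
... | y , refl = y , refl
couple-surjective {suc n} (true ∷ p) {suc x} eq (there x∈) with ∣p∣≡1⇒p≡⁅x⁆ p (ℕ.suc-injective eq)
... | y , refl with x∈⁅y⁆⇒x≡y y x∈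
...   | refl = zero , refl
couple-surjective {suc n} (false ∷ p) {suc x} eq (there x∈) with couple-surjective p eq x∈
... | y , refl = suc y , refl

image : ∀ {m n} → (Fin m → Fin n) → Subset m → Subset n
image f []          = ⊥
image f (true ∷ p)  = ⁅ f zero ⁆ ∪ image (f ∘ suc) p
image f (false ∷ p) = image (f ∘ suc) p

∈-image : ∀ {m n} (f : Fin m → Fin n) {p : Subset m} {a} → a ∈ p → f a ∈ image f p
∈-image f {true ∷ p}  here       = x∈p∪q⁺ (inj₁ (x∈⁅x⁆ _))
∈-image f {true ∷ p}  (there a∈) = x∈p∪q⁺ (inj₂ (∈-image (f ∘ suc) a∈))
∈-image f {false ∷ p} (there a∈) = ∈-image (f ∘ suc) a∈

∣p∪q∣≤∣p∣+∣q∣ : ∀ {n} (p q : Subset n) → ∣ p ∪ q ∣ ≤ ∣ p ∣ + ∣ q ∣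
∣p∪q∣≤∣p∣+∣q∣ []          []          = z≤n
∣p∪q∣≤∣p∣+∣q∣ (true ∷ p)  (true ∷ q)  = s≤s (≤-trans (∣p∪q∣≤∣p∣+∣q∣ p q) (+-monoʳ-≤ ∣ p ∣ (n≤1+n _)))
∣p∪q∣≤∣p∣+∣q∣ (true ∷ p)  (false ∷ q) = s≤s (∣p∪q∣≤∣p∣+∣q∣ p q)
∣p∪q∣≤∣p∣+∣q∣ (false ∷ p) (true ∷ q)  = ≤-trans (s≤s (∣p∪q∣≤∣p∣+∣q∣ p q)) (≤-reflexive (≡.sym (+-suc ∣ p ∣ _)))
∣p∪q∣≤∣p∣+∣q∣ (false ∷ p) (false ∷ q) = ∣p∪q∣≤∣p∣+∣q∣ p q

∣image∣≤ : ∀ {m n} (f : Fin m → Fin n) (p : Subset m) → ∣ image f p ∣ ≤ ∣ p ∣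
∣image∣≤ {n = n} f []  = ≤-reflexive (∣⊥∣≡0 n)
∣image∣≤ f (true ∷ p)  = ≤-trans (∣p∪q∣≤∣p∣+∣q∣ ⁅ f zero ⁆ _)
  (+-mono-≤ (≤-reflexive (∣⁅x⁆∣≡1 (f zero))) (∣image∣≤ (f ∘ suc) p))
∣image∣≤ f (false ∷ p) = ∣image∣≤ (f ∘ suc) p

∈-─⁻ : ∀ {n} (p q : Subset n) {a} → a ∈ p ─ q → a ∉ q
∈-─⁻ (true ∷ p) (false ∷ q) here       ()
∈-─⁻ (x ∷ p)    (y ∷ q)     (there a∈) (there a∈q) = ∈-─⁻ p q a∈ a∈q

-- Peeling

-- Deleting `x` from `ys` keeps the inclusion of the remaining elements, as `x` does not recur in
-- `xs`. Degrees are lengths of filtered lists, so both bounds on degrees rest on this.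
length-⊆ : ∀ {A : Set} {xs ys : List A} → Unique xs → (∀ {x} → x List.∈ xs → x List.∈ ys) →
           length xs ≤ length ys
length-⊆ [] _ = z≤n
length-⊆ {xs = x ∷ xs} {ys} (x∉ ∷ uniq) sub with List.∈-∃++ (sub (here refl))
... | us , vs , refl = ≤-trans
  (s≤s (length-⊆ uniq λ y∈ → remove y∈ (sub (there y∈))))
  (≤-reflexive (trans (cong suc (List.length-++ us))
    (trans (≡.sym (+-suc (length us) _)) (≡.sym (List.length-++ us)))))
  where
  remove : ∀ {y} → y List.∈ xs → y List.∈ us ++ x ∷ vs → y List.∈ us ++ vs
  remove y∈xs y∈ with List.∈-++⁻ us y∈
  ... | inj₁ y∈us         = List.∈-++⁺ˡ y∈us
  ... | inj₂ (here refl)  = contradiction refl (All.lookup x∉ y∈xs)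
  ... | inj₂ (there y∈vs) = List.∈-++⁺ʳ us y∈vs

lookup-injective : ∀ {A : Set} {xs : List A} → Unique xs → ∀ {i j} →
                   List.lookup xs i ≡ List.lookup xs j → i ≡ j
lookup-injective (_ ∷ _)    {zero}  {zero}  _  = refl
lookup-injective (x∉ ∷ _)   {zero}  {suc j} eq = contradiction eq (All.lookup x∉ (List.∈-lookup j))
lookup-injective (x∉ ∷ _)   {suc i} {zero}  eq = contradiction (≡.sym eq) (All.lookup x∉ (List.∈-lookup i))
lookup-injective (_ ∷ uniq) {suc i} {suc j} eq = cong suc (lookup-injective uniq eq)

-- H is the part of a hypergraph with edge list E that its vertex set induces.
record Induced {n} (E : List (Subset n)) (H : Residual n) : Set where
  field
    sound    : ∀ {e} → e List.∈ hyperedges H → e List.∈ E × e ⊆ vertices H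
    complete : ∀ {e} → e List.∈ E → e ⊆ vertices H → e List.∈ hyperedges H
    unique   : Unique (hyperedges H)

open Induced

induced-whole : ∀ {d} (G : Hypergraph d) → Induced (edges G) (whole G)
induced-whole G = record { sound = λ e∈ → e∈ , λ _ → ∈⊤ ; complete = λ e∈ _ → e∈ ; unique = simple G }

-- An edge passes the filter exactly when it misses `V`, that is, when it stays inside the remaining
-- vertices.
induced-∖ : ∀ {n E} {H : Residual n} V → Induced E H → Induced E (H ∖ V)
induced-∖ {H = H} V ind = record
  { sound    = λ e∈ → let e∈H , disjoint = List.∈-filter⁻ _ {xs = hyperedges H} e∈
                          e∈E , e⊆ = sound ind e∈H
                      in e∈E , λ a∈ → x∈p∧x∉q⇒x∈p─q (e⊆ a∈) (λ a∈V → disjoint (_ , x∈p∩q⁺ (a∈ , a∈V)))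
  ; complete = λ {e} e∈E e⊆ → List.∈-filter⁺ _
      (complete ind e∈E (λ a∈ → p─q⊆p (vertices H) V (e⊆ a∈)))
      (λ (_ , a∈) → let a∈e , a∈V = x∈p∩q⁻ e V a∈ in ∈-─⁻ (vertices H) V (e⊆ a∈e) a∈V)
  ; unique   = Unique.filter⁺ _ (unique ind)
  }

induced-star : ∀ {k n E} {H C : Residual n} → Star (Peel k) H C → Induced E H → Induced E C
induced-star ε                    ind = ind
induced-star (peel v _ _ ◅ peels) ind = induced-star peels (induced-∖ ⁅ v ⁆ ind)

star-⊆ : ∀ {k n} {H C : Residual n} → Star (Peel k) H C → vertices C ⊆ vertices H
star-⊆ ε a∈ = a∈
star-⊆ {H = H} (peel v _ _ ◅ peels) a∈ = p─q⊆p (vertices H) ⁅ v ⁆ (star-⊆ peels a∈)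

-- Peeling lowers the number of vertices, and a residual in which nothing can be peeled is its own
-- core.
core-exists : ∀ k {n} (H : Residual n) → ∃[ C ] IsCore k H C
core-exists k H = go H (<-wellFounded _)
  where
  go : ∀ H → Acc _<_ ∣ vertices H ∣ → ∃[ C ] IsCore k H C
  go H (acc rec) with any? (λ v → v ∈? vertices H ×-dec degree H v <? k)
  ... | yes (v , v∈ , low) with go (H ∖ ⁅ v ⁆) (rec (x∈p⇒∣p-x∣<∣p∣ v∈))
  ...   | C , peels , core = C , peel v v∈ low ◅ peels , core
  go H _ | no none = H , ε , λ v v∈ → ℕ.≮⇒≥ (λ low → none (v , v∈ , low))

degree-≥ : ∀ {n} (H : Residual n) {v} es → Unique es → (∀ {e} → e List.∈ es → e List.∈ hyperedges H × v ∈ e) →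
           length es ≤ degree H v
degree-≥ H {v} es uniq sub = length-⊆ uniq λ e∈ → let e∈H , v∈e = sub e∈ in List.∈-filter⁺ (v ∈?_) e∈H v∈e

degree-≤ : ∀ {n} (H : Residual n) {v} es → Unique (hyperedges H) →
           (∀ {e} → e List.∈ hyperedges H → v ∈ e → e List.∈ es) → degree H v ≤ length es
degree-≤ H {v} es uniq sub = length-⊆ (Unique.filter⁺ (v ∈?_) uniq)
  λ e∈ → let e∈H , v∈e = List.∈-filter⁻ (v ∈?_) {xs = hyperedges H} e∈ in sub e∈H v∈e

-- The first vertex of `U` to be peeled would have degree below `k` while all of `U` is still
-- present. The density hypothesis ranges over all induced residuals because the surroundings of `U`
-- shrink meanwhile.
persistent : ∀ {k n} {E : List (Subset n)} {H C : Residual n} (U : Subset n) →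
             (∀ {H} → Induced E H → U ⊆ vertices H → ∀ {v} → v ∈ U → k ≤ degree H v) →
             Induced E H → U ⊆ vertices H → Star (Peel k) H C → U ⊆ vertices C
persistent U dense ind U⊆ ε = U⊆
persistent {k} {E = E} {H} U dense ind U⊆ (peel v v∈ low ◅ peels) =
  persistent {k} {E = E} U dense (induced-∖ ⁅ v ⁆ ind)
    (λ {a} a∈ → x∈p∧x∉q⇒x∈p─q (U⊆ a∈) λ a∈v →
      ℕ.<⇒≱ low (dense ind U⊆ (subst (_∈ U) (x∈⁅y⁆⇒x≡y v a∈v) a∈)))
    peels

filter-nonempty : ∀ {n k} (H : Residual n) {v} → suc k ≤ degree H v → ∃[ e ] (e List.∈ hyperedges H × v ∈ e)
filter-nonempty H {v} pos with List.filter (v ∈?_) (hyperedges H) in eq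
... | e ∷ _ = e , List.∈-filter⁻ (v ∈?_) {xs = hyperedges H} (subst (e List.∈_) (≡.sym eq) (here refl))

-- The first argument is to be recovered only from values at members of `ys`: in the application,
-- rows of different copies do coincide for sets outside the gadget, such as the empty one.
cartesian-unique : ∀ {A B C : Set} (f : A → B → C) {xs ys} → Unique xs → Unique ys →
  (∀ x {y y′} → f x y ≡ f x y′ → y ≡ y′) →
  (∀ {x x′ y y′} → y List.∈ ys → y′ List.∈ ys → f x y ≡ f x′ y′ → x ≡ x′) →
  Unique (List.cartesianProductWith f xs ys)
cartesian-unique f [] uys inj inj′ = []
cartesian-unique f {x ∷ xs} {ys} (x∉ ∷ uxs) uys inj inj′ =
  Unique.++⁺ (Unique.map⁺ (inj x) uys) (cartesian-unique f uxs uys inj inj′)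
    λ (z∈ , z∈′) → disjoint z∈ z∈′
  where
  disjoint : ∀ {z} → z List.∈ List.map (f x) ys → ¬ (z List.∈ List.cartesianProductWith f xs ys)
  disjoint z∈ z∈′ with List.∈-map⁻ (f x) z∈ | List.∈-cartesianProductWith⁻ f xs ys z∈′
  ... | y , y∈ , refl | x′ , y′ , x′∈ , y′∈ , eq = All.lookup x∉ x′∈ (inj′ y∈ y′∈ eq)

-- Turing machines from structured programs

Tapes Heads Actions : Set
Tapes   = Vec (Tape 0) 3
Heads   = Vec (Cell 0) 3
Actions = Vec (Cell 0 × Move) 3

-- A machine that leaves through `nothing`, performing the accompanying
-- actions on its way out.
record Routine : Set₁ where
  field
    State  : Set
    finite : ∃[ q ] (State ↔ Fin q)
    start  : State
    δ      : State → Heads → Maybe State × Actions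

open Routine

data Exec (r : Routine) (q : State r) (ts : Tapes) : ℕ → Tapes → Set where
  leave : ∀ {as} → δ r q (Vec.map Tape.head ts) ≡ (nothing , as) →
          Exec r q ts 1 (zipWith act as ts)
  go    : ∀ {q′ as n us} → δ r q (Vec.map Tape.head ts) ≡ (just q′ , as) →
          Exec r q′ (zipWith act as ts) n us → Exec r q ts (suc n) us

-- A bound in place of the exact time lets every loop be charged in terms of one common `l`, so that
-- the total depends on the input length alone.
record Run (r : Routine) (ts : Tapes) (n : ℕ) (us : Tapes) : Set where
  constructor within
  field
    {time} : ℕ
    time≤  : time ≤ n
    exec   : Exec r (start r) ts time us

weaken : ∀ {r ts m n us} → m ≤ n → Run r ts m us → Run r ts n us
weaken m≤n (within t≤m e) = within (≤-trans t≤m m≤n) e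

⊎-finite : {A B : Set} → ∃[ p ] (A ↔ Fin p) → ∃[ q ] (B ↔ Fin q) →
           ∃[ n ] ((A ⊎ B) ↔ Fin n)
⊎-finite (_ , f) (_ , g) = _ , (↔-sym +↔⊎ ↔-∘ (f ⊎-↔ g))

Fin-finite : ∀ n → ∃[ q ] (Fin n ↔ Fin q)
Fin-finite n = n , ↔-id (Fin n)

prim : (Heads → Actions) → Routine
prim f = record
  { State = Fin 1 ; finite = Fin-finite 1 ; start = zero ; δ = λ _ hs → nothing , f hs }

infixr 5 _⨟_
-- The step in which `r` leaves already enters `start s`, so times add without overhead.
_⨟_ : Routine → Routine → Routine
r ⨟ s = record
  { State  = State r ⊎ State s
  ; finite = ⊎-finite (finite r) (finite s)
  ; start  = inj₁ (start r)
  ; δ      = λ where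
      (inj₁ q) hs → map₁ (just ∘ Maybe.maybe inj₁ (inj₂ (start s))) (δ r q hs)
      (inj₂ q) hs → map₁ (Maybe.map inj₂) (δ s q hs)
  }

idle : Heads → Actions
idle = Vec.map (_, stay)

-- The test is an idle step of its own, and the step in which the body leaves returns to it; this is
-- the `suc` in `run-loop`.
while : Fin 3 → (Cell 0 → Bool) → Routine → Routine
while j P r = record
  { State  = Fin 1 ⊎ State r
  ; finite = ⊎-finite (Fin-finite 1) (finite r)
  ; start  = inj₁ zero
  ; δ      = λ where
      (inj₁ _) hs → (if P (Vec.lookup hs j) then just (inj₂ (start r)) else nothing) , idle hs
      (inj₂ q) hs → map₁ (just ∘ Maybe.maybe inj₂ (inj₁ zero)) (δ r q hs)
  }

idle-≡ : ∀ {n} (ts : Vec (Tape 0) n) →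
         zipWith act (Vec.map (_, stay) (Vec.map Tape.head ts)) ts ≡ ts
idle-≡ []       = refl
idle-≡ (t ∷ ts) = cong (t ∷_) (idle-≡ ts)

run-prim : ∀ {f} ts → Run (prim f) ts 1 (zipWith act (f (Vec.map Tape.head ts)) ts)
run-prim ts = within ≤-refl (leave refl)

run-⨟ : ∀ {r s ts us vs m n} → Run r ts m us → Run s us n vs → Run (r ⨟ s) ts (m + n) vs
run-⨟ {r} {s} {m = m} {n} (within t≤m e) (within u≤n e′) =
  within (+-mono-≤ t≤m u≤n) (first e)
  where
  second : ∀ {q ts t vs} → Exec s q ts t vs → Exec (r ⨟ s) (inj₂ q) ts t vs
  second (leave eq) = leave (cong (map₁ (Maybe.map inj₂)) eq)
  second (go eq e)  = go (cong (map₁ (Maybe.map inj₂)) eq) (second e)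

  first : ∀ {q ts t} → Exec r q ts t _ → Exec (r ⨟ s) (inj₁ q) ts (t + _) _
  first (leave eq) = go (cong (map₁ (just ∘ Maybe.maybe inj₁ _)) eq) (second e′)
  first (go eq e)  = go (cong (map₁ (just ∘ Maybe.maybe inj₁ _)) eq) (first e)

run-done : ∀ {j P r ts} → P (Vec.lookup (Vec.map Tape.head ts) j) ≡ false →
           Run (while j P r) ts 1 ts
run-done {j} {P} {r} {ts} stop = within ≤-refl
  (subst (Exec _ _ ts 1) (idle-≡ ts) (leave (cong (λ b → (if b then _ else _) , _) stop)))

run-loop : ∀ {j P r ts us vs m n} → P (Vec.lookup (Vec.map Tape.head ts) j) ≡ true →
           Run r ts m us → Run (while j P r) us n vs →
           Run (while j P r) ts (suc m + n) vs
run-loop {j} {P} {r} {ts} continue (within t≤m e) (within u≤n e′) =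
  within (s≤s (+-mono-≤ t≤m u≤n))
    (go (cong (λ b → (if b then _ else _) , _) continue)
      (subst (λ ts → Exec (while j P r) _ ts _ _) (≡.sym (idle-≡ ts)) (body e)))
  where
  body : ∀ {q ts t} → Exec r q ts t _ → Exec (while j P r) (inj₂ q) ts (t + _) _
  body (leave eq) = go (cong (map₁ (just ∘ Maybe.maybe inj₂ _)) eq) e′
  body (go eq e)  = go (cong (map₁ (just ∘ Maybe.maybe inj₂ _)) eq) (body e)

-- A Turing machine halts without acting, whereas a routine acts while leaving. The extra state is
-- where it halts, and the number of steps is unchanged.
machine : Routine → TuringMachine
machine r = record
  { work   = 1
  ; marks  = 0
  ; State  = State r ⊎ Fin 1
  ; finite = ⊎-finite (finite r) (Fin-finite 1)
  ; start  = inj₁ (start r)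
  ; δ      = λ where
      (inj₁ q) hs → just (map₁ (Maybe.maybe inj₁ (inj₂ zero)) (δ r q hs))
      (inj₂ _) hs → nothing
  }

module _ (r : Routine) where
  open TuringMachine (machine r)

  run-machine : ∀ {w n us} → Run r (inputTape w ∷ Vec.replicate 2 blankTape) n us →
                ∃[ t ] (t ≤ n × initial w ⇓[ t ] (inj₂ zero , us))
  run-machine {us = us} (within t≤n e) = _ , t≤n , lift e
    where
    lift : ∀ {q ts t} → Exec r q ts t us → (inj₁ q , ts) ⇓[ t ] (inj₂ zero , us)
    lift {ts = ts} (leave eq) = next
      (cong (λ (q′ , as) → just (Maybe.maybe inj₁ (inj₂ zero) q′ , zipWith act as ts)) eq) (halt refl)
    lift {ts = ts} (go eq e)  = next
      (cong (λ (q′ , as) → just (Maybe.maybe inj₁ (inj₂ zero) q′ , zipWith act as ts)) eq) (lift e)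

-- at ls zs scans the first cell of zs; both at ls [] and at ls (blank ∷ [])
-- are the tape with a blank scanned cell and nothing to its right.
at : List (Cell 0) → List (Cell 0) → Tape 0
at ls []       = tape ls blank []
at ls (z ∷ zs) = tape ls z zs

first : List (Cell 0) → Cell 0
first []      = blank
first (z ∷ _) = z

head-at : ∀ {ls} zs → Tape.head (at ls zs) ≡ first zs
head-at []      = refl
head-at (_ ∷ _) = refl

-- Moves and scans on a single tape

on : Fin 3 → (Cell 0 → Cell 0) → Move → Routine
on j g m = prim (λ hs → idle hs [ j ]≔ (g (Vec.lookup hs j) , m))

walk : Fin 3 → Move → Routine
walk j = on j id

put : Fin 3 → Symbol → Routine
put j s = on j (λ _ → sym s) goRight

-- Written as updates at `j`, one statement serves all three tapes, and for concrete `j` the update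
-- computes away. The entry of `ts` at `j` is a mere placeholder, supplied as `blankTape` or `_` in
-- the uses of this and the following lemmas.
run-on : ∀ {j g m t} ts → Run (on j g m) (ts [ j ]≔ t) 1 (ts [ j ]≔ act (g (Tape.head t) , m) t)
run-on {0F} (_ ∷ _ ∷ _ ∷ []) = run-prim _
run-on {1F} (_ ∷ _ ∷ _ ∷ []) = run-prim _
run-on {2F} (_ ∷ _ ∷ _ ∷ []) = run-prim _

right-at : ∀ ls {z} zs → move goRight (at ls (z ∷ zs)) ≡ at (z ∷ ls) zs
right-at ls []      = refl
right-at ls (_ ∷ _) = refl

-- Unlike in `at`, the head is not on the first cell of zs but on the one before it.
before : List (Cell 0) → List (Cell 0) → Tape 0
before []       zs = tape [] blank zs
before (l ∷ ls) zs = tape ls l zs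

left-at : ∀ ls {z} zs → move goLeft (at ls (z ∷ zs)) ≡ before ls (z ∷ zs)
left-at []       zs = refl
left-at (l ∷ ls) zs = refl

run-walk : ∀ {j m t} ts → Run (walk j m) (ts [ j ]≔ t) 1 (ts [ j ]≔ move m t)
run-walk ts = run-on {g = id} ts

run-walkʳ : ∀ j {ls z} zs ts →
            Run (walk j goRight) (ts [ j ]≔ at ls (z ∷ zs)) 1 (ts [ j ]≔ at (z ∷ ls) zs)
run-walkʳ j {ls} {z} zs ts =
  subst (λ t → Run (walk j goRight) (ts [ j ]≔ at ls (z ∷ zs)) 1 (ts [ j ]≔ t)) (right-at ls zs) (run-walk ts)

run-walkˡ : ∀ j ls {z zs} ts →
            Run (walk j goLeft) (ts [ j ]≔ at ls (z ∷ zs)) 1 (ts [ j ]≔ before ls (z ∷ zs))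
run-walkˡ j ls {z} {zs} ts =
  subst (λ t → Run (walk j goLeft) (ts [ j ]≔ at ls (z ∷ zs)) 1 (ts [ j ]≔ t)) (left-at ls zs) (run-walk ts)

run-put : ∀ j {s ls c zs} ts →
          Run (put j s) (ts [ j ]≔ at ls (c ∷ zs)) 1 (ts [ j ]≔ at (sym s ∷ ls) zs)
run-put j {s} {ls} {c} {zs} ts =
  subst (λ t → Run (put j s) (ts [ j ]≔ at ls (c ∷ zs)) 1 (ts [ j ]≔ t)) (right-at ls zs) (run-on {g = λ _ → sym s} ts)

head-≔ : ∀ {j : Fin 3} {t} (ts : Tapes) →
         Vec.lookup (Vec.map Tape.head (ts [ j ]≔ t)) j ≡ Tape.head t
head-≔ {0F} (_ ∷ _ ∷ _ ∷ []) = refl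
head-≔ {1F} (_ ∷ _ ∷ _ ∷ []) = refl
head-≔ {2F} (_ ∷ _ ∷ _ ∷ []) = refl

Holds Fails : (Cell 0 → Bool) → Cell 0 → Set
Holds P c = P c ≡ true
Fails P c = P c ≡ false

scanʳ : ∀ {j P ls zs} ts {n} xs → All (Holds P) xs → Fails P (first zs) →
        length xs ≤ n →
        Run (while j P (walk j goRight)) (ts [ j ]≔ at ls (xs ++ zs)) (n * 2 + 1)
            (ts [ j ]≔ at (xs ʳ++ ls) zs)
scanʳ {j} {P} {ls} {zs} ts {n} [] [] stop _ =
  weaken (m≤n+m 1 (n * 2)) (run-done (trans (cong P (trans (head-≔ ts) (head-at zs))) stop))
scanʳ {j} {P} {ls} {zs} ts {suc n} (x ∷ xs) (px ∷ pxs) stop (s≤s l) =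
  run-loop (trans (cong P (head-≔ ts)) px)
    (run-walkʳ j (xs ++ zs) ts)
    (scanʳ ts xs pxs stop l)

scanˡ : ∀ {j P l ls} ts {n} zs xs → All (Holds P) xs → Fails P l → length xs ≤ n →
        Run (while j P (walk j goLeft)) (ts [ j ]≔ before (xs ++ l ∷ ls) zs) (n * 2 + 1)
            (ts [ j ]≔ tape ls l (xs ʳ++ zs))
scanˡ {P = P} ts {n} zs [] [] stop _ =
  weaken (m≤n+m 1 (n * 2)) (run-done (trans (cong P (head-≔ ts)) stop))
scanˡ {j} {P} {l} {ls} ts {suc n} zs (x ∷ xs) (px ∷ pxs) stop (s≤s len) =
  run-loop (trans (cong P (head-≔ ts)) px)
    (run-walkˡ j (xs ++ l ∷ ls) ts)
    (scanˡ ts (x ∷ zs) xs pxs stop len)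

ʳ++⁺ : ∀ {A : Set} {P : A → Set} {xs ys} → All P xs → All P ys → All P (xs ʳ++ ys)
ʳ++⁺ []         pys = pys
ʳ++⁺ (px ∷ pxs) pys = ʳ++⁺ pxs (px ∷ pys)

back : Fin 3 → (Cell 0 → Bool) → Routine
back j P = walk j goLeft ⨟ while j P (walk j goLeft)

run-back : ∀ {j P l ls z zs} ts {n} xs → All (Holds P) xs → Fails P l → length xs ≤ n →
           Run (back j P) (ts [ j ]≔ at (xs ʳ++ l ∷ ls) (z ∷ zs)) (1 + (n * 2 + 1))
               (ts [ j ]≔ at ls (l ∷ xs ++ z ∷ zs))
run-back {j} {P} {l} {ls} {z} {zs} ts {n} xs pxs stop len =
  subst₂ (λ t u → Run (back j P) (ts [ j ]≔ t) (1 + (n * 2 + 1)) (ts [ j ]≔ u))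
    (cong (λ us → at us (z ∷ zs)) (≡.sym (List.ʳ++-defn xs)))
    (cong (tape ls l) (trans (List.ʳ++-defn (reverse xs)) (cong (_++ z ∷ zs) (List.reverse-involutive xs))))
    (run-⨟
      (run-walkˡ j (reverse xs ++ l ∷ ls) ts)
      (scanˡ ts (z ∷ zs) (reverse xs) (ʳ++⁺ pxs []) stop
        (≤-trans (≤-reflexive (List.length-reverse xs)) len)))

isBlank nonblank isSep isBit is𝟘 is𝟙 notSep : Cell 0 → Bool
isBlank blank = true
isBlank _     = false

nonblank = not ∘ isBlank

isSep (sym ♯) = true
isSep _       = false

notSep = not ∘ isSep

is𝟘 (sym 𝟘) = true
is𝟘 _       = false

is𝟙 (sym 𝟙) = true
is𝟙 _       = false

isBit c = is𝟘 c ∨ is𝟙 c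

rewind : Fin 3 → Routine
rewind j = back j nonblank ⨟ walk j goRight

run-rewind : ∀ {j ls z zs} ts {n} xs → All (Holds nonblank) xs → length xs ≤ n →
             Run (rewind j) (ts [ j ]≔ at (xs ʳ++ blank ∷ ls) (z ∷ zs)) (1 + (n * 2 + 1) + 1)
                 (ts [ j ]≔ at (blank ∷ ls) (xs ++ z ∷ zs))
run-rewind {j} {ls} {z} {zs} ts xs pxs len =
  run-⨟ (run-back ts xs pxs refl len)
        (run-walkʳ j (xs ++ z ∷ zs) ts)

cells : List Symbol → List (Cell 0)
cells = List.map sym

push : List Symbol → List (Cell 0) → List (Cell 0)
push w o = cells w ʳ++ o

push-++ : ∀ v {w o} → push (v ++ w) o ≡ push w (push v o)
push-++ v {w} {o} = trans (cong (_ʳ++ o) (List.map-++ sym v w)) (List.++-ʳ++ (cells v))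

replicate-ʳ++-∷ : ∀ {A : Set} n {x : A} {ys} → x ∷ (List.replicate n x ʳ++ ys) ≡ List.replicate n x ʳ++ x ∷ ys
replicate-ʳ++-∷ zero    = refl
replicate-ʳ++-∷ (suc n) = replicate-ʳ++-∷ n

-- Every routine takes at least one step; with a continuation `r` the empty word costs nothing.
-- `copyRows` has the same form.
emits : ∀ {n} → Vec Symbol n → Routine → Routine
emits []      r = r
emits (s ∷ w) r = put 1F s ⨟ emits w r

run-emits : ∀ {n i k o r m ts} (w : Vec Symbol n) →
            Run r (i ∷ at (push (Vec.toList w) o) [] ∷ k ∷ []) m ts →
            Run (emits w r) (i ∷ at o [] ∷ k ∷ []) (n + m) ts
run-emits []      run = run
run-emits (s ∷ w) run = run-⨟ (run-put 1F (_ ∷ blankTape ∷ _ ∷ [])) (run-emits w run)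

times : ∀ {n} → ℕ → Vec Symbol n → List Symbol
times r w = List.concat (List.replicate r (Vec.toList w))

spread : ∀ {n} → (Cell 0 → Bool) → Vec Symbol n → Routine
spread P w = while 2F P (emits w (walk 2F goRight))

run-spread : ∀ {n i o ls zs P c} r {l} (w : Vec Symbol n) →
             Holds P c → Fails P (first zs) → r ≤ l →
             Run (spread P w)
               (i ∷ at o [] ∷ at ls (List.replicate r c ++ zs) ∷ []) (l * (1 + (n + 1)) + 1)
               (i ∷ at (push (times r w) o) [] ∷ at (List.replicate r c ʳ++ ls) zs ∷ [])
run-spread {zs = zs} {P} zero {l} w holds fails _ =
  weaken (m≤n+m 1 (l * _)) (run-done (trans (cong P (head-at zs)) fails))
run-spread {n} {o = o} {ls} {zs} {P} {c} (suc r) {suc l} w holds fails (s≤s r≤l) =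
  weaken (≤-reflexive (≡.sym (+-assoc (1 + (n + 1)) (l * (1 + (n + 1))) 1)))
  (run-loop holds
    (run-emits w (run-walkʳ 2F (List.replicate r c ++ zs) (_ ∷ _ ∷ blankTape ∷ [])))
    (subst (λ o′ → Run (spread P w)
                     (_ ∷ at (push (Vec.toList w) o) [] ∷ at (c ∷ ls) (List.replicate r c ++ zs) ∷ [])
                     (l * (1 + (n + 1)) + 1)
                     (_ ∷ at o′ [] ∷ at (List.replicate r c ʳ++ (c ∷ ls)) zs ∷ []))
      (≡.sym (push-++ (Vec.toList w)))
      (run-spread r w holds fails r≤l)))

-- Writing the new incidence matrix

bits : ∀ {n} → Vec Bool n → List Symbol
bits v = List.map bit (Vec.toList v)

-- Cuts a row at its ones, each preceded by a run of zeros, with the successive ones overwritten by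
-- the successive bits of `q`. The constructors follow the control flow of `fill`.
data Filling : ∀ {m} → Vec Bool m → List Symbol → List Symbol → Set where
  finish  : ∀ a → Filling [] (List.replicate a 𝟘) (List.replicate a 𝟘)
  replace : ∀ a {m b v w} {q : Vec Bool m} → Filling q v w →
            Filling (b ∷ q) (List.replicate a 𝟘 ++ 𝟙 ∷ v) (List.replicate a 𝟘 ++ bit b ∷ w)

skip : ∀ {m v w} {q : Vec Bool m} → Filling q v w → Filling q (𝟘 ∷ v) (𝟘 ∷ w)
skip (finish a)    = finish (suc a)
skip (replace a f) = replace (suc a) f

filling : ∀ {m n} (q : Vec Bool m) (e : Subset n) → ∣ e ∣ ≡ m →
          Filling q (bits e) (bits (expand q e))
filling []      []          _  = finish 0
filling (x ∷ q) (true ∷ e)  eq = replace 0 (filling q e (ℕ.suc-injective eq))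
filling q       (false ∷ e) eq = skip (filling q e eq)

zeros : Routine
zeros = while 0F is𝟘 (emits (𝟘 ∷ []) (walk 0F goRight))

fill : ∀ {m} → Vec Bool m → Routine
fill []      = zeros
fill (b ∷ q) = zeros ⨟ emits (bit b ∷ []) (walk 0F goRight) ⨟ fill q

run-zeros : ∀ {ls zs o k l} a → a ≤ l → Fails is𝟘 (first zs) →
            Run zeros (at ls (cells (List.replicate a 𝟘) ++ zs) ∷ at o [] ∷ k ∷ []) (l * 3 + 1)
                      (at (push (List.replicate a 𝟘) ls) zs ∷ at (push (List.replicate a 𝟘) o) [] ∷ k ∷ [])
run-zeros {zs = zs} {l = l} zero _ stop =
  weaken (m≤n+m 1 (l * 3)) (run-done (trans (cong is𝟘 (head-at zs)) stop))
run-zeros {zs = zs} (suc a) (s≤s a≤l) stop =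
  run-loop refl
    (run-emits (𝟘 ∷ []) (run-walkʳ 0F (cells (List.replicate a 𝟘) ++ zs) (blankTape ∷ _ ∷ _ ∷ [])))
    (run-zeros a a≤l stop)

-- Each of the `suc m` runs of zeros is charged the full length `l`, at three steps per cell (test,
-- write, move), with one failed test and two steps for the one that follows.
run-fill : ∀ {m q v w ls zs o k l} → Filling {m} q v w → length v ≤ l → Fails is𝟘 (first zs) →
           Run (fill q) (at ls (cells v ++ zs) ∷ at o [] ∷ k ∷ []) (suc m * (l * 3 + 3))
                        (at (push v ls) zs ∷ at (push w o) [] ∷ k ∷ [])
run-fill {l = l} (finish a) len stop =
  weaken (≤-trans (+-monoʳ-≤ (l * 3) (s≤s z≤n)) (m≤m+n _ _))
    (run-zeros a (≤-trans (≤-reflexive (≡.sym (List.length-replicate a))) len) stop)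
run-fill {suc m} {q = b ∷ q} {ls = ls} {zs} {o} {k} {l} (replace a {v = v} {w} f) len stop =
  subst₂ (λ c (ls′ , o′) → Run (fill (b ∷ q)) (at ls c ∷ at o [] ∷ k ∷ []) (suc (suc m) * (l * 3 + 3))
                             (at ls′ zs ∷ at o′ [] ∷ k ∷ []))
    (trans (≡.sym (List.++-assoc (cells 0ᵃ) (cells (𝟙 ∷ v)) zs))
           (cong (_++ zs) (≡.sym (List.map-++ sym 0ᵃ (𝟙 ∷ v)))))
    (cong₂ _,_ (≡.sym (push-++ 0ᵃ)) (≡.sym (push-++ 0ᵃ)))
    (weaken (≤-reflexive (trans (≡.sym (+-assoc (l * 3 + 1) 2 _)) (cong (_+ suc m * (l * 3 + 3)) (+-assoc (l * 3) 1 2))))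
      (run-⨟ (run-zeros a (≤-trans (m≤m+n a _) len′) refl)
      (run-⨟ (run-emits (bit b ∷ []) (run-walkʳ 0F (cells v ++ zs) (blankTape ∷ _ ∷ _ ∷ [])))
             (run-fill f (≤-trans (n≤1+n _) (≤-trans (m≤n+m _ a) len′)) stop))))
  where
  0ᵃ = List.replicate a 𝟘
  len′ : a + suc (length v) ≤ l
  len′ = ≤-trans (≤-reflexive (≡.sym (trans (List.length-++ 0ᵃ) (cong (_+ suc (length v)) (List.length-replicate a))))) len

-- The counter holds 𝟘 for each of the i edges already replaced and 𝟙 for each of
-- the r pending ones; between passes the head rests on the blank to its right.
stack : ℕ → ℕ → List (Cell 0)
stack i r = List.replicate r (sym 𝟙) ʳ++ (List.replicate i (sym 𝟘) ʳ++ blank ∷ [])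

counter : ℕ → ℕ → List (Cell 0)
counter i r = List.replicate i (sym 𝟘) ++ List.replicate r (sym 𝟙)

counter-stack : ∀ i r → counter i r ʳ++ blank ∷ [] ≡ stack i r
counter-stack i r = List.++-ʳ++ (List.replicate i (sym 𝟘))

run-rewindCounter : ∀ {t u l} i r → i + r ≤ l →
  Run (rewind 2F) (t ∷ u ∷ at (stack i r) [] ∷ []) (1 + (l * 2 + 1) + 1)
      (t ∷ u ∷ at (blank ∷ []) (List.replicate i (sym 𝟘) ++ List.replicate r (sym 𝟙) ++ blank ∷ []) ∷ [])
run-rewindCounter {t} {u} {l} i r i+r≤l =
  subst₂ (λ x y → Run (rewind 2F) (t ∷ u ∷ at x [] ∷ []) _ (t ∷ u ∷ at (blank ∷ []) y ∷ []))
    (counter-stack i r) (List.++-assoc (List.replicate i (sym 𝟘)) _ _)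
    (run-rewind {2F} {zs = []} (t ∷ u ∷ blankTape ∷ []) (counter i r)
      (All.++⁺ (All.replicate⁺ i refl) (All.replicate⁺ r refl))
      (≤-trans (≤-reflexive (trans (List.length-++ (List.replicate i (sym 𝟘)))
        (cong₂ _+_ (List.length-replicate i) (List.length-replicate r)))) i+r≤l))

rowOf : ∀ {c n} → ℕ → ℕ → Vec Bool (2 + c) → Subset n → List Symbol
rowOf {c} i r (x ∷ y ∷ p) e =
  bits (expand (x ∷ y ∷ []) e) ++ times i (Vec.replicate c 𝟘) ++
  Vec.toList (Vec.map bit p) ++ times r (Vec.replicate c 𝟘)

-- Each 𝟘 of the counter calls for a zero block, the first 𝟙 for the block of the current edge, each
-- later 𝟙 for a zero block again. The final return to ♯ lets the next gadget edge read the same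
-- row.
copyRow : ∀ {c} → Vec Bool (2 + c) → Routine
copyRow {c} (x ∷ y ∷ p) =
  emits (♯ ∷ []) (walk 0F goRight) ⨟ fill (x ∷ y ∷ []) ⨟
  rewind 2F ⨟ spread is𝟘 (Vec.replicate c 𝟘) ⨟
  emits (Vec.map bit p) (walk 2F goRight) ⨟ spread is𝟙 (Vec.replicate c 𝟘) ⨟
  back 0F notSep

copyRow-cost : ℕ → ℕ → ℕ
copyRow-cost c l =
  2 + (3 * (l * 3 + 3) + ((1 + (l * 2 + 1) + 1) + ((l * (1 + (c + 1)) + 1) +
  ((c + 1) + ((l * (1 + (c + 1)) + 1) + (1 + (l * 2 + 1)))))))

bits-notSep : ∀ {n} (v : Vec Bool n) → All (Holds notSep) (cells (bits v))
bits-notSep []          = []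
bits-notSep (false ∷ v) = refl ∷ bits-notSep v
bits-notSep (true ∷ v)  = refl ∷ bits-notSep v

length-bits : ∀ {n} (v : Vec Bool n) → length (bits v) ≡ n
length-bits {n} v = trans (List.length-map bit (Vec.toList v)) (Vec.length-toList v)

replicate-++-first : ∀ {P x z zs} r → Fails P x → Fails P z →
                     Fails P (first (List.replicate r x ++ z ∷ zs))
replicate-++-first zero    fx fz = fz
replicate-++-first (suc r) fx fz = fx

run-copyRow : ∀ {c n ls z zs o l} i r (q : Vec Bool (2 + c)) (e : Subset n) →
              ∣ e ∣ ≡ 2 → Fails is𝟘 z → n ≤ l → i + suc r ≤ l →
              let t = at ls (sym ♯ ∷ cells (bits e) ++ z ∷ zs)
                  k = at (stack i (suc r)) []
              in Run (copyRow q) (t ∷ at o [] ∷ k ∷ []) (copyRow-cost c l)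
                     (t ∷ at (push (♯ ∷ rowOf i r q e) o) [] ∷ k ∷ [])
run-copyRow {c} {n} {ls} {z} {zs} {o} {l} i r (x ∷ y ∷ p) e ∣e∣≡2 stop n≤l m≤l =
  subst (λ o′ → Run (copyRow (x ∷ y ∷ p)) _ _ (_ ∷ at o′ [] ∷ _ ∷ []))
    (≡.sym (trans (push-++ (bits (expand (x ∷ y ∷ []) e)))
           (trans (push-++ (times i 0ᶜ)) (push-++ (Vec.toList (Vec.map bit p))))))
  (run-⨟ (run-emits (♯ ∷ []) (run-walkʳ 0F _ (blankTape ∷ _ ∷ _ ∷ [])))
  (run-⨟ (run-fill (filling (x ∷ y ∷ []) e ∣e∣≡2) (≤-trans (≤-reflexive (length-bits e)) n≤l) stop)
  (run-⨟ (run-rewindCounter i (suc r) m≤l)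
  (run-⨟ (run-spread {ls = blank ∷ []} i 0ᶜ refl refl (≤-trans (m≤m+n i (suc r)) m≤l))
  (run-⨟ (run-emits (Vec.map bit p) (run-walkʳ 2F _ (_ ∷ _ ∷ blankTape ∷ [])))
  (run-⨟ (run-spread {zs = blank ∷ []} r 0ᶜ refl refl (≤-trans (≤-trans (n≤1+n r) (m≤n+m (suc r) i)) m≤l))
         (run-back {0F} {l = sym ♯} {ls} {z} {zs} (blankTape ∷ _ ∷ _ ∷ []) (cells (bits e)) (bits-notSep e) refl
           (≤-trans (≤-reflexive (trans (List.length-map sym (bits e)) (length-bits e))) n≤l))))))))
  where 0ᶜ = Vec.replicate c 𝟘

copyRows : ∀ {c} → List (Vec Bool (2 + c)) → Routine → Routine
copyRows []      s = s
copyRows (q ∷ Q) s = copyRow q ⨟ copyRows Q s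

run-copyRows : ∀ {c n ls z zs o l s m us} i r Q (e : Subset n) →
               ∣ e ∣ ≡ 2 → Fails is𝟘 z → n ≤ l → i + suc r ≤ l →
               let t = at ls (sym ♯ ∷ cells (bits e) ++ z ∷ zs)
                   k = at (stack i (suc r)) []
                   w = List.concatMap (λ q → ♯ ∷ rowOf i r q e) Q
               in Run s (t ∷ at (push w o) [] ∷ k ∷ []) m us →
                  Run (copyRows Q s) (t ∷ at o [] ∷ k ∷ []) (length Q * copyRow-cost c l + m) us
run-copyRows i r []      e ∣e∣≡2 stop n≤l m≤l run = run
run-copyRows {c} {n} {ls} {z} {zs} {o} {l} {s} {m} {us} i r (q ∷ Q) e ∣e∣≡2 stop n≤l m≤l run =
  weaken (≤-reflexive (≡.sym (+-assoc (copyRow-cost c l) (length Q * copyRow-cost c l) m)))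
  (run-⨟ (run-copyRow i r q e ∣e∣≡2 stop n≤l m≤l)
         (run-copyRows i r Q e ∣e∣≡2 stop n≤l m≤l
           (subst (λ o′ → Run s (at ls (sym ♯ ∷ cells (bits e) ++ z ∷ zs) ∷ at o′ [] ∷ at (stack i (suc r)) [] ∷ []) m us)
             (push-++ (♯ ∷ rowOf i r q e)) run)))

-- The continuation leaves the row of the finished edge and turns the first 𝟙 of the counter into 𝟘.
replaceEdge : ∀ {c} → List (Vec Bool (2 + c)) → Routine
replaceEdge Q = copyRows Q
  (walk 0F goRight ⨟ while 0F isBit (walk 0F goRight) ⨟
   rewind 2F ⨟ while 2F is𝟘 (walk 2F goRight) ⨟ put 2F 𝟘 ⨟ while 2F is𝟙 (walk 2F goRight))

replaceEdge-cost : ℕ → ℕ → ℕ → ℕ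
replaceEdge-cost N c l =
  N * copyRow-cost c l + (1 + ((l * 2 + 1) + ((1 + (l * 2 + 1) + 1) + ((l * 2 + 1) + (1 + (l * 2 + 1))))))

bits-isBit : ∀ {n} (v : Vec Bool n) → All (Holds isBit) (cells (bits v))
bits-isBit []          = []
bits-isBit (false ∷ v) = refl ∷ bits-isBit v
bits-isBit (true ∷ v)  = refl ∷ bits-isBit v

length-cells-bits : ∀ {n l} (v : Vec Bool n) → n ≤ l → length (cells (bits v)) ≤ l
length-cells-bits v n≤l = ≤-trans (≤-reflexive (trans (List.length-map sym (bits v)) (length-bits v))) n≤l

length-replicate≤ : ∀ {A : Set} {x : A} {l} r → r ≤ l → length (List.replicate r x) ≤ l
length-replicate≤ r r≤l = ≤-trans (≤-reflexive (List.length-replicate r)) r≤l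

run-replaceEdge : ∀ {c n ls z zs o l} i r (Q : List (Vec Bool (2 + c))) (e : Subset n) →
  ∣ e ∣ ≡ 2 → Fails isBit z → Fails is𝟘 z → n ≤ l → i + suc r ≤ l →
  Run (replaceEdge Q)
      (at ls (sym ♯ ∷ cells (bits e) ++ z ∷ zs) ∷ at o [] ∷ at (stack i (suc r)) [] ∷ [])
      (replaceEdge-cost (length Q) c l)
      (at (push (♯ ∷ bits e) ls) (z ∷ zs) ∷
       at (push (List.concatMap (λ q → ♯ ∷ rowOf i r q e) Q) o) [] ∷
       at (stack (suc i) r) [] ∷ [])
run-replaceEdge {z = z} {zs} {l = l} i r Q e ∣e∣≡2 stop stop′ n≤l m≤l =
  run-copyRows i r Q e ∣e∣≡2 stop′ n≤l m≤l
  (run-⨟ (run-walkʳ 0F _ (blankTape ∷ _ ∷ _ ∷ []))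
  (run-⨟ (scanʳ (blankTape ∷ _ ∷ _ ∷ []) (cells (bits e)) (bits-isBit e) stop (length-cells-bits e n≤l))
  (run-⨟ (run-rewindCounter i (suc r) m≤l)
  (run-⨟ (scanʳ {2F} {ls = blank ∷ []} (_ ∷ _ ∷ blankTape ∷ []) (List.replicate i (sym 𝟘)) (All.replicate⁺ i refl) refl
           (length-replicate≤ i (≤-trans (m≤m+n i (suc r)) m≤l)))
  (run-⨟ (run-put 2F (_ ∷ _ ∷ blankTape ∷ []))
         mark-done)))))
  where
  mark-done : ∀ {t u} → Run (while 2F is𝟙 (walk 2F goRight))
    (t ∷ u ∷ at (sym 𝟘 ∷ (List.replicate i (sym 𝟘) ʳ++ blank ∷ [])) (List.replicate r (sym 𝟙) ++ blank ∷ []) ∷ [])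
    (l * 2 + 1) (t ∷ u ∷ at (stack (suc i) r) [] ∷ [])
  mark-done {t} {u} =
    subst (λ k → Run (while 2F is𝟙 (walk 2F goRight))
             (t ∷ u ∷ at k (List.replicate r (sym 𝟙) ++ blank ∷ []) ∷ [])
             (l * 2 + 1) (t ∷ u ∷ at (stack (suc i) r) [] ∷ []))
      (≡.sym (replicate-ʳ++-∷ i))
      (scanʳ {2F} {zs = blank ∷ []} (t ∷ u ∷ blankTape ∷ []) (List.replicate r (sym 𝟙)) (All.replicate⁺ r refl) refl
        (length-replicate≤ r (≤-trans (≤-trans (n≤1+n r) (m≤n+m (suc r) i)) m≤l)))

-- The loop over the edges

rows : ∀ {n} → List (Subset n) → List Symbol
rows = List.concatMap (λ e → ♯ ∷ bits e)

newRows : ∀ {c n} → List (Vec Bool (2 + c)) → ℕ → List (Subset n) → List Symbol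
newRows Q i []       = []
newRows Q i (e ∷ es) = List.concatMap (λ q → ♯ ∷ rowOf i (length es) q e) Q ++ newRows Q (suc i) es

rows-∷ : ∀ {n} (e : Subset n) es {zs} →
         cells (rows (e ∷ es)) ++ zs ≡ sym ♯ ∷ cells (bits e) ++ cells (rows es) ++ zs
rows-∷ e es {zs} = cong (sym ♯ ∷_) (trans (cong (_++ zs) (List.map-++ sym (bits e) (rows es)))
                                     (List.++-assoc (cells (bits e)) (cells (rows es)) zs))

-- Two bounds are kept apart: `b` limits the remaining rounds and decreases, while `l` limits the
-- lengths within a round and stays fixed.
run-replaceEdges : ∀ {c n ls o l} i (Q : List (Vec Bool (2 + c))) (es : List (Subset n)) b →
  All (λ e → ∣ e ∣ ≡ 2) es → n ≤ l → i + length es ≤ l → length es ≤ b →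
  Run (while 0F isSep (replaceEdge Q))
      (at ls (cells (rows es) ++ blank ∷ []) ∷ at o [] ∷ at (stack i (length es)) [] ∷ [])
      (b * suc (replaceEdge-cost (length Q) c l) + 1)
      (at (push (rows es) ls) (blank ∷ []) ∷ at (push (newRows Q i es) o) [] ∷ at (stack (i + length es) 0) [] ∷ [])
run-replaceEdges {c} {n} {ls} {o} {l} i Q [] b [] n≤l m≤l _ =
  weaken (m≤n+m 1 (b * suc (replaceEdge-cost (length Q) c l)))
    (subst (λ k → Run (while 0F isSep (replaceEdge Q)) (at ls (blank ∷ []) ∷ at o [] ∷ at (stack i 0) [] ∷ []) 1
             (at ls (blank ∷ []) ∷ at o [] ∷ at (stack k 0) [] ∷ []))
      (≡.sym (+-identityʳ i)) (run-done refl))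
run-replaceEdges {c} {n} {ls} {o} {l} i Q (e ∷ es) (suc b) (∣e∣≡2 ∷ w) n≤l m≤l (s≤s len) =
  weaken (≤-reflexive (≡.sym
      (+-assoc (suc (replaceEdge-cost (length Q) c l)) (b * suc (replaceEdge-cost (length Q) c l)) 1)))
    (run-loop-from (step es)
      (subst₂ (λ (ls′ , o′) k → Run (while 0F isSep (replaceEdge Q)) mid
            (b * suc (replaceEdge-cost (length Q) c l) + 1)
            (at ls′ (blank ∷ []) ∷ at o′ [] ∷ at (stack k 0) [] ∷ []))
        (cong₂ _,_ (≡.sym (push-++ (♯ ∷ bits e)))
                   (≡.sym (push-++ (List.concatMap (λ q → ♯ ∷ rowOf i (length es) q e) Q))))
        (≡.sym (+-suc i _))
        (run-replaceEdges (suc i) Q es b w n≤l (≤-trans (≤-reflexive (≡.sym (+-suc i _))) m≤l) len)))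
  where
  mid : Tapes
  mid = at (push (♯ ∷ bits e) ls) (cells (rows es) ++ blank ∷ []) ∷
        at (push (List.concatMap (λ q → ♯ ∷ rowOf i (length es) q e) Q) o) [] ∷
        at (stack (suc i) (length es)) [] ∷ []

  -- The split on `fs` exposes the cell after the row of `e`, a ♯ or the final blank; neither is a
  -- bit.
  step : ∀ fs → Run (replaceEdge Q)
    (at ls (sym ♯ ∷ cells (bits e) ++ cells (rows fs) ++ blank ∷ []) ∷ at o [] ∷ at (stack i (suc (length es))) [] ∷ [])
    (replaceEdge-cost (length Q) c l)
    (at (push (♯ ∷ bits e) ls) (cells (rows fs) ++ blank ∷ []) ∷
       at (push (List.concatMap (λ q → ♯ ∷ rowOf i (length es) q e) Q) o) [] ∷
       at (stack (suc i) (length es)) [] ∷ [])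
  step []      = run-replaceEdge {l = l} i (length es) Q e ∣e∣≡2 refl refl n≤l m≤l
  step (_ ∷ _) = run-replaceEdge {l = l} i (length es) Q e ∣e∣≡2 refl refl n≤l m≤l

  run-loop-from : ∀ {m n us} →
    Run (replaceEdge Q)
      (at ls (sym ♯ ∷ cells (bits e) ++ cells (rows es) ++ blank ∷ []) ∷ at o [] ∷ at (stack i (suc (length es))) [] ∷ [])
      m mid →
    Run (while 0F isSep (replaceEdge Q)) mid n us →
    Run (while 0F isSep (replaceEdge Q))
      (at ls (cells (rows (e ∷ es)) ++ blank ∷ []) ∷ at o [] ∷ at (stack i (suc (length es))) [] ∷ [])
      (suc m + n) us
  run-loop-from {m} first rest = run-loop refl
    (subst (λ x → Run (replaceEdge Q) (at ls x ∷ at o [] ∷ at (stack i (suc (length es))) [] ∷ []) m mid)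
      (≡.sym (rows-∷ e es)) first) rest

-- The prefix of the output and the whole program

blanks : ℕ → List (Cell 0) → List (Cell 0)
blanks n ls = List.replicate n blank ʳ++ ls

-- Erasing the copied prefix s ♯ 1ⁿ makes the later rewind stop at the first row.
transfer : Routine
transfer = prim λ where (a ∷ _ ∷ c ∷ []) → (blank , goRight) ∷ (a , goRight) ∷ (c , stay) ∷ []

run-transfer : ∀ {ls a zs o k} →
               Run transfer (at ls (a ∷ zs) ∷ at o [] ∷ k ∷ []) 1 (at (blank ∷ ls) zs ∷ at (a ∷ o) [] ∷ k ∷ [])
run-transfer {ls} {a} {zs} {o} {k} =
  subst (λ t → Run transfer (at ls (a ∷ zs) ∷ at o [] ∷ k ∷ []) 1 (t ∷ at (a ∷ o) [] ∷ k ∷ []))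
    (right-at ls zs) (run-prim (at ls (a ∷ zs) ∷ at o [] ∷ k ∷ []))

run-transfers : ∀ {P ls zs o k l} w → All (Holds P) (cells w) → Fails P (first zs) → length w ≤ l →
                Run (while 0F P transfer) (at ls (cells w ++ zs) ∷ at o [] ∷ k ∷ []) (l * 2 + 1)
                    (at (blanks (length w) ls) zs ∷ at (push w o) [] ∷ k ∷ [])
run-transfers {P} {zs = zs} {l = l} [] [] stop _ =
  weaken (m≤n+m 1 (l * 2)) (run-done (trans (cong P (head-at zs)) stop))
run-transfers {P} {ls} {zs} {o} {k} {suc l} (s ∷ w) (ps ∷ pw) stop (s≤s len) =
  run-loop ps (run-transfer {zs = cells w ++ zs}) (run-transfers w pw stop len)

-- The output head still stands behind 1ⁿ, so the `c` ones written per edge extend the unary order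
-- to that of the new hypergraph. The rows are only read here, as they are copied later.
countRows : ℕ → Routine
countRows c = while 0F isSep
  (walk 0F goRight ⨟ emits (Vec.replicate c 𝟙) (put 2F 𝟙) ⨟ while 0F isBit (walk 0F goRight))

countRows-cost : ℕ → ℕ → ℕ
countRows-cost c l = 1 + ((c + 1) + (l * 2 + 1))

run-countRows : ∀ {n ls o l} c r (es : List (Subset n)) b → n ≤ l → length es ≤ b →
  Run (countRows c) (at ls (cells (rows es)) ∷ at o [] ∷ at (stack 0 r) [] ∷ [])
      (b * suc (countRows-cost c l) + 1)
      (at (push (rows es) ls) [] ∷ at (push (times (length es) (Vec.replicate c 𝟙)) o) [] ∷
       at (stack 0 (r + length es)) [] ∷ [])
run-countRows {n} {ls} {o} {l} c r [] b n≤l _ =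
  weaken (m≤n+m 1 (b * suc (countRows-cost c l)))
    (subst (λ k → Run (countRows c) (at ls [] ∷ at o [] ∷ at (stack 0 r) [] ∷ []) 1
             (at ls [] ∷ at o [] ∷ at (stack 0 k) [] ∷ []))
      (≡.sym (+-identityʳ r)) (run-done refl))
run-countRows {n} {ls} {o} {l} c r (e ∷ es) (suc b) n≤l (s≤s len) =
  weaken (≤-reflexive (≡.sym (+-assoc (suc (countRows-cost c l)) (b * suc (countRows-cost c l)) 1)))
    (run-loop refl
      (subst (λ x → Run body (at ls (sym ♯ ∷ x) ∷ at o [] ∷ at (stack 0 r) [] ∷ []) (countRows-cost c l) mid)
        (≡.sym (List.map-++ sym (bits e) (rows es)))
        (run-⨟ (run-walkʳ 0F _ (blankTape ∷ _ ∷ _ ∷ []))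
        (run-⨟ (run-emits (Vec.replicate c 𝟙) put𝟙)
               (scanʳ (blankTape ∷ _ ∷ _ ∷ []) (cells (bits e)) (bits-isBit e) (stop es) (length-cells-bits e n≤l)))))
      (subst₂ (λ (ls′ , o′) k → Run (countRows c) mid (b * suc (countRows-cost c l) + 1)
            (at ls′ [] ∷ at o′ [] ∷ at (stack 0 k) [] ∷ []))
        (cong₂ _,_ (≡.sym (push-++ (♯ ∷ bits e))) (≡.sym (push-++ (Vec.toList (Vec.replicate c 𝟙)))))
        (≡.sym (+-suc r _))
        (run-countRows c (suc r) es b n≤l len)))
  where
  body : Routine
  body = walk 0F goRight ⨟ emits (Vec.replicate c 𝟙) (put 2F 𝟙) ⨟ while 0F isBit (walk 0F goRight)

  mid : Tapes
  mid = at (push (♯ ∷ bits e) ls) (cells (rows es)) ∷ at (push (Vec.toList (Vec.replicate c 𝟙)) o) [] ∷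
        at (stack 0 (suc r)) [] ∷ []

  stop : (fs : List (Subset n)) → Fails isBit (first (cells (rows fs)))
  stop []      = refl
  stop (_ ∷ _) = refl

  put𝟙 : ∀ {t u} → Run (put 2F 𝟙) (t ∷ u ∷ at (stack 0 r) [] ∷ []) 1 (t ∷ u ∷ at (stack 0 (suc r)) [] ∷ [])
  put𝟙 {t} {u} = subst (λ k → Run (put 2F 𝟙) (t ∷ u ∷ at (stack 0 r) [] ∷ []) 1 (t ∷ u ∷ at k [] ∷ []))
    (replicate-ʳ++-∷ r) (run-put 2F {zs = []} (t ∷ u ∷ blankTape ∷ []))

-- The two initial moves leave a blank on the left of the output and of the
-- counter, where rewinding stops.
program : ∀ {c} → List (Vec Bool (2 + c)) → Routine
program {c} Q =
  walk 1F goRight ⨟ walk 2F goRight ⨟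
  while 0F notSep transfer ⨟ transfer ⨟ while 0F is𝟙 transfer ⨟ countRows c ⨟ rewind 0F ⨟
  while 0F isSep (replaceEdge Q) ⨟ rewind 1F

program-cost : ℕ → ℕ → ℕ → ℕ → ℕ
program-cost N c l L =
  1 + (1 + ((l * 2 + 1) + (1 + ((l * 2 + 1) + ((l * suc (countRows-cost c l) + 1) + ((1 + (l * 2 + 1) + 1) +
  ((l * suc (replaceEdge-cost N c l) + 1) + (1 + (L * 2 + 1) + 1))))))))

oldText : ∀ {n} → List Symbol → List (Subset n) → List Symbol
oldText {n} S es = S ++ ♯ ∷ List.replicate n 𝟙 ++ rows es

newText : ∀ {c n} → List (Vec Bool (2 + c)) → List Symbol → List (Subset n) → List Symbol
newText {c} {n} Q S es =
  S ++ ♯ ∷ List.replicate n 𝟙 ++ times (length es) (Vec.replicate c 𝟙) ++ newRows Q 0 es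

inputTape-at : ∀ w → inputTape w ≡ at [] (cells w)
inputTape-at []      = refl
inputTape-at (_ ∷ _) = refl

cells-nonblank : ∀ w → All (Holds nonblank) (cells w)
cells-nonblank []      = []
cells-nonblank (_ ∷ w) = refl ∷ cells-nonblank w

length-cells : ∀ {l} w → length w ≤ l → length (cells w) ≤ l
length-cells w len = ≤-trans (≤-reflexive (List.length-map sym w)) len

run-program : ∀ {c n l L} (Q : List (Vec Bool (2 + c))) S (es : List (Subset n)) →
  All (Holds notSep) (cells S) → All (λ e → ∣ e ∣ ≡ 2) es →
  length S ≤ l → n ≤ l → length es ≤ l → length (rows es) ≤ l → length (newText Q S es) ≤ L →
  ∃[ t ] ∃[ k ] Run (program Q) (inputTape (oldText S es) ∷ blankTape ∷ blankTape ∷ [])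
    (program-cost (length Q) c l L)
    (t ∷ at (blank ∷ []) (cells (newText Q S es) ++ blank ∷ []) ∷ k ∷ [])
run-program {c} {n} {l} {L} Q S es bitsS weight S≤l n≤l m≤l rows≤l W≤L = _ , _ ,
  subst (λ t → Run (program Q) (t ∷ blankTape ∷ blankTape ∷ []) (program-cost (length Q) c l L)
                   (at (push (rows es) left) (blank ∷ []) ∷
                    at (blank ∷ []) (cells (newText Q S es) ++ blank ∷ []) ∷
                    at (stack (length es) 0) [] ∷ []))
    (≡.sym (trans (inputTape-at (oldText S es)) (cong (at []) eq)))
    (run-⨟ (run-walk {1F} (_ ∷ blankTape ∷ _ ∷ []))
    (run-⨟ (run-walk {2F} (_ ∷ _ ∷ blankTape ∷ []))
    (run-⨟ (run-transfers S bitsS refl S≤l)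
    (run-⨟ (run-transfer {zs = cells 1ⁿ ++ cells (rows es)})
    (run-⨟ (run-transfers 1ⁿ (all𝟙 n) (stop es) (≤-trans (≤-reflexive (List.length-replicate n)) n≤l))
    (run-⨟ (run-countRows {o = push 1ⁿ (sym ♯ ∷ push S (blank ∷ []))} c 0 es l n≤l m≤l)
    (run-⨟ rewindInput
    (run-⨟ (run-replaceEdges 0 Q es l weight n≤l m≤l m≤l) rewindOutput))))))))
  where
  1ⁿ = List.replicate n 𝟙

  left : List (Cell 0)
  left = blanks (length 1ⁿ) (blank ∷ blanks (length S) [])

  eq : cells (oldText S es) ≡ cells S ++ sym ♯ ∷ cells 1ⁿ ++ cells (rows es)
  eq = trans (List.map-++ sym S _) (cong (λ x → cells S ++ sym ♯ ∷ x) (List.map-++ sym 1ⁿ (rows es)))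

  stop : (fs : List (Subset n)) → Fails is𝟙 (first (cells (rows fs)))
  stop []      = refl
  stop (_ ∷ _) = refl

  all𝟙 : ∀ n → All (Holds is𝟙) (cells (List.replicate n 𝟙))
  all𝟙 zero    = []
  all𝟙 (suc n) = refl ∷ all𝟙 n

  rewindInput : ∀ {o k} → Run (rewind 0F) (at (push (rows es) left) [] ∷ o ∷ k ∷ []) (1 + (l * 2 + 1) + 1)
                              (at left (cells (rows es) ++ blank ∷ []) ∷ o ∷ k ∷ [])
  rewindInput {o} {k} =
    subst (λ ls → Run (rewind 0F) (at (push (rows es) ls) [] ∷ o ∷ k ∷ []) (1 + (l * 2 + 1) + 1)
                              (at ls (cells (rows es) ++ blank ∷ []) ∷ o ∷ k ∷ []))
      -- The erased ♯ guarantees a blank to the left of the rows even when `n` is zero.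
      (replicate-ʳ++-∷ (length 1ⁿ))
      (run-rewind {zs = []} (blankTape ∷ o ∷ k ∷ []) (cells (rows es))
        (cells-nonblank (rows es)) (length-cells (rows es) rows≤l))

  rewindOutput : ∀ {t k} → Run (rewind 1F)
    (t ∷ at (push (newRows Q 0 es) (push (times (length es) (Vec.replicate c 𝟙))
              (push 1ⁿ (sym ♯ ∷ push S (blank ∷ []))))) [] ∷ k ∷ [])
    (1 + (L * 2 + 1) + 1) (t ∷ at (blank ∷ []) (cells (newText Q S es) ++ blank ∷ []) ∷ k ∷ [])
  rewindOutput {t} {k} =
    subst (λ o → Run (rewind 1F) (t ∷ at o [] ∷ k ∷ []) (1 + (L * 2 + 1) + 1)
                   (t ∷ at (blank ∷ []) (cells (newText Q S es) ++ blank ∷ []) ∷ k ∷ []))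
      (trans (push-++ S) (trans (push-++ 1ⁿ) (push-++ (times (length es) (Vec.replicate c 𝟙)))))
      (run-rewind {1F} {zs = []} (t ∷ blankTape ∷ k ∷ []) (cells (newText Q S es)) (cells-nonblank (newText Q S es))
        (length-cells (newText Q S es) W≤L))

-- The written text as an encoded incidence matrix

replicate-+ : ∀ {A : Set} m {n} {x : A} → List.replicate (m + n) x ≡ List.replicate m x ++ List.replicate n x
replicate-+ zero    = refl
replicate-+ (suc m) = cong (_ ∷_) (replicate-+ m)

times-replicate : ∀ r c s → times r (Vec.replicate c s) ≡ List.replicate (r * c) s
times-replicate zero    c s = refl
times-replicate (suc r) c s =
  trans (cong₂ _++_ (Vec.toList-replicate c s) (times-replicate r c s)) (≡.sym (replicate-+ c))

bits-++ : ∀ {m n} (u : Vec Bool m) (v : Vec Bool n) → bits (u Vec.++ v) ≡ bits u ++ bits v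
bits-++ u v = trans (cong (List.map bit) (Vec.toList-++ u v)) (List.map-++ bit (Vec.toList u) (Vec.toList v))

bits-⊥ : ∀ n → bits (⊥ {n}) ≡ List.replicate n 𝟘
bits-⊥ zero    = refl
bits-⊥ (suc n) = cong (𝟘 ∷_) (bits-⊥ n)

bits-block : ∀ {m c} (i : Fin m) (p : Subset c) →
             bits (block i p) ≡ times (toℕ i) (Vec.replicate c 𝟘) ++ Vec.toList (Vec.map bit p) ++
                                times (m ∸ suc (toℕ i)) (Vec.replicate c 𝟘)
bits-block {suc m} {c} zero p = trans (bits-++ p (⊥ {m * c}))
  (cong₂ _++_ (≡.sym (Vec.toList-map bit p)) (trans (bits-⊥ (m * c)) (≡.sym (times-replicate m c 𝟘))))
bits-block {suc m} {c} (suc i) p = trans (bits-++ (⊥ {c}) (block i p))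
  (trans (cong₂ _++_ (trans (bits-⊥ c) (≡.sym (Vec.toList-replicate c 𝟘))) (bits-block i p))
         (≡.sym (List.++-assoc (Vec.toList (Vec.replicate c 𝟘)) (times (toℕ i) (Vec.replicate c 𝟘)) _)))

-- The hypergraph numbers the copies by `allFin`, the machine by a running counter. The offset `j`
-- and the arbitrary `F` absorb the shift of indices at each edge.
newRows-tabulate : ∀ {c n} (Q : List (Vec Bool (2 + c))) (es : List (Subset n)) j
  (F : Fin (length es) → List Symbol) →
  (∀ i → F i ≡ List.concatMap (λ q → ♯ ∷ rowOf (j + toℕ i) (length es ∸ suc (toℕ i)) q (List.lookup es i)) Q) →
  List.concat (List.tabulate F) ≡ newRows Q j es
newRows-tabulate Q []       j F eq = refl
newRows-tabulate Q (e ∷ es) j F eq = cong₂ _++_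
  (trans (eq zero) (cong (λ k → List.concatMap (λ q → ♯ ∷ rowOf k (length es) q e) Q) (+-identityʳ j)))
  (newRows-tabulate Q es (suc j) (F ∘ suc) λ i → trans (eq (suc i))
    (cong (λ k → List.concatMap (λ q → ♯ ∷ rowOf k (length es ∸ suc (toℕ i)) q (List.lookup es i)) Q) (+-suc j (toℕ i))))

rows-product : ∀ {A B : Set} {n} (f : A → B → Subset n) xs ys →
  rows (List.cartesianProductWith f xs ys) ≡ List.concatMap (λ x → List.concatMap (λ y → ♯ ∷ bits (f x y)) ys) xs
rows-product f []       ys = refl
rows-product f (x ∷ xs) ys =
  trans (List.concatMap-++ _ (List.map (f x) ys) _)
        (cong₂ _++_ (List.concatMap-map _ (f x) ys) (rows-product f xs ys))

-- Running time

-- The degree is an index that computes, so building a bound along the shape of a cost checks its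
-- degree. Zero is excluded because a positive constant is not bounded by a multiple of `l ^ p`
-- there when `p` is positive; an encoding always contains a ♯.
record Poly (p : ℕ) (f : ℕ → ℕ) : Set where
  constructor poly
  field
    coefficient : ℕ
    bound       : ∀ l → .{{NonZero l}} → f l ≤ coefficient * l ^ p

constᵖ : ∀ a → Poly 0 (λ _ → a)
constᵖ a = poly a λ _ → ≤-reflexive (≡.sym (*-identityʳ a))

idᵖ : Poly 1 id
idᵖ = poly 1 λ l → ≤-reflexive (≡.sym (trans (*-identityˡ (l ^ 1)) (*-identityʳ l)))

infixl 6 _+ᵖ_
infixl 7 _*ᵖ_

_+ᵖ_ : ∀ {p q f g} → Poly p f → Poly q g → Poly (p ⊔ q) (λ l → f l + g l)
_+ᵖ_ {p} {q} (poly a f≤) (poly b g≤) = poly (a + b) λ l → ≤-trans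
  (+-mono-≤ (≤-trans (f≤ l) (*-monoʳ-≤ a (^-monoʳ-≤ l (m≤m⊔n p q))))
            (≤-trans (g≤ l) (*-monoʳ-≤ b (^-monoʳ-≤ l (m≤n⊔m p q)))))
  (≤-reflexive (≡.sym (*-distribʳ-+ (l ^ (p ⊔ q)) a b)))

_*ᵖ_ : ∀ {p q f g} → Poly p f → Poly q g → Poly (p + q) (λ l → f l * g l)
_*ᵖ_ {p} {q} (poly a f≤) (poly b g≤) = poly (a * b) λ l → ≤-trans (*-mono-≤ (f≤ l) (g≤ l)) (≤-reflexive
  (trans ([m*n]*[o*p]≡[m*o]*[n*p] a (l ^ p) b (l ^ q)) (cong (a * b *_) (≡.sym (^-distribˡ-+-* l p q)))))

sucᵖ : ∀ {p f} → Poly p f → Poly p (suc ∘ f)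
sucᵖ f≤ = constᵖ 1 +ᵖ f≤

-- The summands: `l` for the prefix s ♯ 1ⁿ, `l * c` for the added ones, and `N` rows for each of at
-- most `l` edges, a row being a separator, at most `l` old bits and at most `l` blocks of `c` bits.
newText-bound : ℕ → ℕ → ℕ → ℕ
newText-bound N c l = l + (l * c + l * (N * (1 + (l + l * c))))

scanᵖ : Poly 1 (λ l → l * 2 + 1)
scanᵖ = idᵖ *ᵖ constᵖ 2 +ᵖ constᵖ 1

rewindᵖ : Poly 1 (λ l → 1 + (l * 2 + 1) + 1)
rewindᵖ = constᵖ 1 +ᵖ scanᵖ +ᵖ constᵖ 1

copyRowᵖ : ∀ c → Poly 1 (copyRow-cost c)
copyRowᵖ c = constᵖ 2 +ᵖ (constᵖ 3 *ᵖ (idᵖ *ᵖ constᵖ 3 +ᵖ constᵖ 3) +ᵖ (rewindᵖ +ᵖ (spreadᵖ +ᵖ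
  (constᵖ (c + 1) +ᵖ (spreadᵖ +ᵖ (constᵖ 1 +ᵖ scanᵖ))))))
  where
  spreadᵖ : Poly 1 (λ l → l * (1 + (c + 1)) + 1)
  spreadᵖ = idᵖ *ᵖ constᵖ (1 + (c + 1)) +ᵖ constᵖ 1

replaceEdgeᵖ : ∀ N c → Poly 1 (replaceEdge-cost N c)
replaceEdgeᵖ N c = constᵖ N *ᵖ copyRowᵖ c +ᵖ
  (constᵖ 1 +ᵖ (scanᵖ +ᵖ (rewindᵖ +ᵖ (scanᵖ +ᵖ (constᵖ 1 +ᵖ scanᵖ)))))

newTextᵖ : ∀ N c → Poly 2 (newText-bound N c)
newTextᵖ N c = idᵖ +ᵖ (idᵖ *ᵖ constᵖ c +ᵖ idᵖ *ᵖ (constᵖ N *ᵖ (constᵖ 1 +ᵖ (idᵖ +ᵖ idᵖ *ᵖ constᵖ c))))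

programᵖ : ∀ N c → Poly 2 (λ l → program-cost N c l (newText-bound N c l))
programᵖ N c = constᵖ 1 +ᵖ (constᵖ 1 +ᵖ (scanᵖ +ᵖ (constᵖ 1 +ᵖ (scanᵖ +ᵖ
  (idᵖ *ᵖ sucᵖ (constᵖ 1 +ᵖ (constᵖ (c + 1) +ᵖ scanᵖ)) +ᵖ constᵖ 1 +ᵖ (rewindᵖ +ᵖ
  (idᵖ *ᵖ sucᵖ (replaceEdgeᵖ N c) +ᵖ constᵖ 1 +ᵖ
  (constᵖ 1 +ᵖ (newTextᵖ N c *ᵖ constᵖ 2 +ᵖ constᵖ 1) +ᵖ constᵖ 1))))))))

length-times : ∀ r c s → length (times r (Vec.replicate c s)) ≡ r * c
length-times r c s = trans (cong length (times-replicate r c s)) (List.length-replicate (r * c))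

length-rowOf : ∀ {c n l} i r (q : Vec Bool (2 + c)) (e : Subset n) → n ≤ l → i + suc r ≤ l →
               length (rowOf i r q e) ≤ l + l * c
length-rowOf {c} {n} {l} i r (x ∷ y ∷ p) e n≤l m≤l = ≤-trans
  (≤-reflexive (trans (List.length-++ (bits (expand (x ∷ y ∷ []) e)))
    (cong₂ _+_ (length-bits (expand (x ∷ y ∷ []) e))
    (trans (List.length-++ (times i (Vec.replicate c 𝟘))) (cong₂ _+_ (length-times i c 𝟘)
      (trans (List.length-++ (Vec.toList (Vec.map bit p)))
        (cong₂ _+_ (Vec.length-toList (Vec.map bit p)) (length-times r c 𝟘))))))))
  (+-mono-≤ n≤l (≤-trans (≤-reflexive (≡.sym (*-distribʳ-+ c i (suc r)))) (*-monoˡ-≤ c m≤l)))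

length-newRows : ∀ {c n l} (Q : List (Vec Bool (2 + c))) i (es : List (Subset n)) → n ≤ l → i + length es ≤ l →
                 length (newRows Q i es) ≤ length es * (length Q * (1 + (l + l * c)))
length-newRows Q i [] n≤l m≤l = z≤n
length-newRows {c} {n} {l} Q i (e ∷ es) n≤l m≤l = ≤-trans
  (≤-reflexive (List.length-++ (List.concatMap (λ q → ♯ ∷ rowOf i (length es) q e) Q)))
  (+-mono-≤ (copies Q) (length-newRows Q (suc i) es n≤l (≤-trans (≤-reflexive (≡.sym (+-suc i _))) m≤l)))
  where
  copies : ∀ Q → length (List.concatMap (λ q → ♯ ∷ rowOf i (length es) q e) Q) ≤ length Q * (1 + (l + l * c))
  copies []      = z≤n
  copies (q ∷ Q) = ≤-trans (≤-reflexive (List.length-++ (♯ ∷ rowOf i (length es) q e)))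
    (+-mono-≤ (s≤s (length-rowOf i (length es) q e n≤l m≤l)) (copies Q))

length-newText : ∀ {c n l} (Q : List (Vec Bool (2 + c))) S (es : List (Subset n)) →
                 length S + suc n ≤ l → n ≤ l → length es ≤ l →
                 length (newText Q S es) ≤ newText-bound (length Q) c l
length-newText {c} {n} {l} Q S es S≤l n≤l m≤l = ≤-trans
  (≤-reflexive (trans (List.length-++ S) (trans
    (cong (λ x → length S + suc x) (trans (List.length-++ (List.replicate n 𝟙)) (cong₂ _+_ (List.length-replicate n)
      (trans (List.length-++ (times (length es) (Vec.replicate c 𝟙)))
        (cong (_+ length (newRows Q 0 es)) (length-times (length es) c 𝟙))))))
    (≡.sym (+-assoc (length S) (suc n) _)))))
  (+-mono-≤ S≤l (+-mono-≤ (*-monoˡ-≤ c m≤l)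
    (≤-trans (length-newRows Q 0 es n≤l m≤l) (*-monoˡ-≤ _ m≤l))))

length-rows : ∀ {n} (es : List (Subset n)) → length es ≤ length (rows es)
length-rows []       = z≤n
length-rows (e ∷ es) = s≤s (≤-trans (length-rows es)
  (≤-trans (m≤n+m _ (length (bits e))) (≤-reflexive (≡.sym (List.length-++ (bits e))))))

symbolPrefix-cells : ∀ w → symbolPrefix {0} (cells w ++ blank ∷ []) ≡ w
symbolPrefix-cells []      = refl
symbolPrefix-cells (s ∷ w) = cong (s ∷_) (symbolPrefix-cells w)

contents-at : ∀ ls w → contents (at ls (cells w ++ blank ∷ [])) ≡ w
contents-at ls []      = refl
contents-at ls (s ∷ w) = cong (s ∷_) (symbolPrefix-cells w)

digits-notSep : ∀ ds → All (Holds notSep) (cells (List.map binaryDigit ds))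
digits-notSep []              = []
digits-notSep (zero ∷ ds)     = refl ∷ digits-notSep ds
digits-notSep (suc zero ∷ ds) = refl ∷ digits-notSep ds

-- The reduction

module Reduction (k′ d′ : ℕ) where

  -- Private vertices per edge: k - 1 completing the edge to a clique on
  -- k + 1 vertices, and d - 2 that pad the edges of that clique.
  c : ℕ
  c = suc k′ + d′

  padded : Subset (3 + k′) → Subset (2 + c)
  padded p = p Vec.++ ⊤ {d′}

  -- With `k = 2 + k′` and `d = 2 + d′`, gadget vertices 0 and 1 stand for u and v, the next
  -- `suc k′` for the wⱼ, and the last `d′` for the padding.
  gadget : List (Subset (2 + c))
  gadget = List.map padded (combos 2 (3 + k′))

  gadget⁻ : ∀ {q} → q List.∈ gadget → ∃[ p ] (∣ p ∣ ≡ 2 × q ≡ padded p)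
  gadget⁻ q∈ with List.∈-map⁻ padded q∈
  ... | p , p∈ , eq = p , ∈-combos⁻ 2 p∈ , eq

  ∣gadget∣ : ∀ {q} → q List.∈ gadget → ∣ q ∣ ≡ 2 + d′
  ∣gadget∣ q∈ with gadget⁻ q∈
  ... | p , eq , refl = trans (∣++∣ p (⊤ {d′})) (cong₂ _+_ eq (∣⊤∣≡n d′))

  ↑ˡ-assoc : ∀ (x : Fin 2) → (x ↑ˡ suc k′) ↑ˡ d′ ≡ x ↑ˡ c
  ↑ˡ-assoc 0F = refl
  ↑ˡ-assoc 1F = refl

  padded-injective : ∀ {p p′} → padded p ≡ padded p′ → p ≡ p′
  padded-injective {p} {p′} = Vec.++-injectiveˡ p p′

  module Construction {n} (es : List (Subset n)) (weight : All (λ e → ∣ e ∣ ≡ 2) es) (distinct : Unique es) where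

    m : ℕ
    m = length es

    -- The vertices of one copy. Old vertices precede private ones, so the two ends receive gadget
    -- vertices 0 and 1.
    mask : Fin m → Subset (n + m * c)
    mask i = List.lookup es i Vec.++ block i (⊤ {c})

    row : Fin m → Subset (2 + c) → Subset (n + m * c)
    row i q = expand q (mask i)

    newEdges : List (Subset (n + m * c))
    newEdges = List.cartesianProductWith row (List.allFin m) gadget

    ∣edge∣ : ∀ i → ∣ List.lookup es i ∣ ≡ 2
    ∣edge∣ i = All.lookup weight (List.∈-lookup i)

    ∣block⊤∣ : ∀ (i : Fin m) → ∣ block i (⊤ {c}) ∣ ≡ c
    ∣block⊤∣ i = trans (∣block∣ i ⊤) (∣⊤∣≡n c)

    ∣mask∣ : ∀ i → ∣ mask i ∣ ≡ 2 + c
    ∣mask∣ i = trans (∣++∣ (List.lookup es i) _) (cong₂ _+_ (∣edge∣ i) (∣block⊤∣ i))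

    ι : Fin m → Fin (2 + c) → Fin (n + m * c)
    ι i = pos (mask i) (∣mask∣ i)

    newEdges⁺ : ∀ i p → ∣ p ∣ ≡ 2 → row i (padded p) List.∈ newEdges
    newEdges⁺ i p eq = List.∈-cartesianProductWith⁺ row (List.∈-allFin i) (List.∈-map⁺ padded (∈-combos⁺ p eq))

    newEdges⁻ : ∀ {e} → e List.∈ newEdges → ∃[ i ] ∃[ p ] (∣ p ∣ ≡ 2 × e ≡ row i (padded p))
    newEdges⁻ e∈ with List.∈-cartesianProductWith⁻ row (List.allFin m) gadget e∈
    ... | i , q , _ , q∈ , refl with gadget⁻ q∈
    ...   | p , eq , refl = i , p , eq , refl

    ι-row : ∀ i p {x} → x ∈ p → ι i (x ↑ˡ d′) ∈ row i (padded p)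
    ι-row i p x∈ = pos-expand⁺ (padded p) (mask i) (∣mask∣ i) (∈-++⁺ˡ x∈)

    new-uniform : All (λ e → ∣ e ∣ ≡ 2 + d′) newEdges
    new-uniform = All.tabulate λ e∈ → size (List.∈-cartesianProductWith⁻ row (List.allFin m) gadget e∈)
      where
      size : ∀ {e} → ∃[ i ] ∃[ q ] (i List.∈ List.allFin m × q List.∈ gadget × e ≡ row i q) → ∣ e ∣ ≡ 2 + d′
      size (i , q , _ , q∈ , refl) = trans (∣expand∣ q (mask i) (∣mask∣ i)) (∣gadget∣ q∈)

    ι-edge : ∀ i (x : Fin 2) → ι i (x ↑ˡ c) ≡ pos (List.lookup es i) (∣edge∣ i) x ↑ˡ (m * c)
    ι-edge i = pos-++ˡ (List.lookup es i) (block i ⊤) (∣edge∣ i) (∣mask∣ i)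

    ι-private : ∀ i (b : Fin c) → ι i (suc (suc b)) ≡ n ↑ʳ pos (block i ⊤) (∣block⊤∣ i) b
    ι-private i = pos-++ʳ (List.lookup es i) (block i ⊤) (∣edge∣ i) (∣block⊤∣ i) (∣mask∣ i)

    private-unshared : ∀ {i j b} → ι i (suc (suc b)) ∈ mask j → i ≡ j
    private-unshared {i} {j} {b} a∈ = trans (≡.sym (quotient-block i (pos-∈ (block i ⊤) (∣block⊤∣ i) b)))
      (quotient-block j (∈-++⁻ʳ (List.lookup es j) (subst (_∈ mask j) (ι-private i b) a∈)))

    -- For d = 2 the edge {u, v} is itself in the gadget, and the copies are told
    -- apart only by it.
    row-without-private : ∀ i {q} → q List.∈ gadget → (∀ b → suc (suc b) ∉ q) →
                          ∃[ f ] row i q ≡ List.lookup es i Vec.++ f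
    row-without-private i {x ∷ y ∷ r} q∈ none = expand r (block i ⊤) ,
      trans (expand-++ (x ∷ y ∷ []) r (List.lookup es i) (block i ⊤) (∣edge∣ i))
            (cong (Vec._++ expand r (block i ⊤)) (full x y big))
      where
      r≡⊥ : r ≡ ⊥
      r≡⊥ = Empty-unique λ (b , b∈) → none b (there (there b∈))

      big : 2 ≤ ∣ x ∷ y ∷ [] ∣
      big = ℕ.+-cancelʳ-≤ 0 2 _ (≤-trans (s≤s (s≤s z≤n)) (≤-reflexive
        (trans (≡.sym (∣gadget∣ q∈)) (trans (∣++∣ (x ∷ y ∷ []) r)
          (cong (∣ x ∷ y ∷ [] ∣ +_) (trans (cong ∣_∣ r≡⊥) (∣⊥∣≡0 c)))))))

      full : ∀ x y → 2 ≤ ∣ x ∷ y ∷ [] ∣ → expand (x ∷ y ∷ []) (List.lookup es i) ≡ List.lookup es i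
      full true  true  _ = expand-⊤ (List.lookup es i) (∣edge∣ i)
      full true  false (s≤s ())
      full false true  (s≤s ())
      full false false ()

    -- If the copies differ, a common row contains no private vertex of either. On the old vertices
    -- it is then the full edge of `G` on both sides, and edges of `G` are distinct.
    row-index : ∀ {i j q q′} → q List.∈ gadget → q′ List.∈ gadget → row i q ≡ row j q′ → i ≡ j
    row-index {i} {j} {q} {q′} q∈ q′∈ eq with i ≟ j
    ... | yes i≡j = i≡j
    ... | no  i≢j with row-without-private i q∈ (λ b b∈ → i≢j (foreign eq b∈))
                     | row-without-private j q′∈ (λ b b∈ → i≢j (≡.sym (foreign (≡.sym eq) b∈)))
      where
      foreign : ∀ {i j q q′ b} → row i q ≡ row j q′ → suc (suc b) ∈ q → i ≡ j
      foreign {i} {j} {q} {q′} eq b∈ = private-unshared (expand-⊆ q′ (mask j)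
        (subst (_ ∈_) eq (pos-expand⁺ q (mask i) (∣mask∣ i) b∈)))
    ...   | f , eqᵢ | g , eqⱼ = lookup-injective distinct
      (Vec.++-injectiveˡ _ _ (trans (≡.sym eqᵢ) (trans eq eqⱼ)))

    row-injective : ∀ i {q q′} → row i q ≡ row i q′ → q ≡ q′
    row-injective i = expand-injective (mask i) (∣mask∣ i)

    new-simple : Unique newEdges
    new-simple = cartesian-unique row (Unique.allFin⁺ m)
      (Unique.map⁺ padded-injective (combos-unique 2 (3 + k′))) row-injective row-index

    G′ : Hypergraph (2 + d′)
    G′ = record { order = n + m * c ; edges = newEdges ; uniform = new-uniform ; simple = new-simple }

    -- Degrees inside a copy and the two directions

    star : Fin m → Fin (3 + k′) → List (Subset (n + m * c))
    star i x = List.map (λ y → row i (padded (couple x y))) (List.allFin (2 + k′))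

    star-unique : ∀ i x → Unique (star i x)
    star-unique i x = Unique.map⁺
      (λ eq → couple-injective x (padded-injective (row-injective i eq))) (Unique.allFin⁺ (2 + k′))

    -- The vertex `v` need not be `x` itself: a padding vertex lies on every edge of the copy, so
    -- the star at `zero` bounds its degree too.
    dense-star : ∀ {H} → Induced newEdges H → ∀ i x {v} → mask i ⊆ vertices H →
                 (∀ y → v ∈ row i (padded (couple x y))) → 2 + k′ ≤ degree H v
    dense-star {H} ind i x {v} mask⊆ through = subst (_≤ degree H v)
      (trans (List.length-map _ (List.allFin (2 + k′))) (List.length-tabulate {n = 2 + k′} (λ y → y)))
      (degree-≥ H (star i x) (star-unique i x) λ e∈ → member (List.∈-map⁻ _ e∈))
      where
      member : ∀ {e} → ∃[ y ] (y List.∈ List.allFin (2 + k′) × e ≡ row i (padded (couple x y))) →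
               e List.∈ hyperedges H × v ∈ e
      member (y , _ , refl) =
        complete ind (newEdges⁺ i (couple x y) (∣couple∣ x y)) (λ a∈ → mask⊆ (expand-⊆ _ (mask i) a∈)) , through y

    mask-dense : ∀ i {H} → Induced newEdges H → mask i ⊆ vertices H → ∀ {v} → v ∈ mask i → 2 + k′ ≤ degree H v
    mask-dense i ind mask⊆ v∈ with pos-surjective (mask i) (∣mask∣ i) v∈
    ... | z , refl with splitAt (3 + k′) z in eq
    ...   | inj₁ x = dense-star ind i x mask⊆ λ y → pos-expand⁺ (padded (couple x y)) (mask i) (∣mask∣ i)
                       (subst (_∈ padded (couple x y)) (splitAt⁻¹-↑ˡ {3 + k′} eq) (∈-++⁺ˡ (∈-couple x y)))
    ...   | inj₂ b = dense-star ind i zero mask⊆ λ y → pos-expand⁺ (padded (couple zero y)) (mask i) (∣mask∣ i)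
                       (subst (_∈ padded (couple zero y)) (splitAt⁻¹-↑ʳ {3 + k′} eq) (∈-++⁺ʳ (couple zero y) ∈⊤))

    -- Of the k gadget edges at a clique vertex, one contains the missing end.
    sparse : ∀ {C} → Induced newEdges C → ∀ i (x₀ : Fin 2) (b : Fin (suc k′)) →
             ι i (x₀ ↑ˡ c) ∉ vertices C → degree C (ι i (suc (suc b) ↑ˡ d′)) < 2 + k′
    sparse {C} ind i x₀ b gone = s≤s (subst (degree C (ι i (w ↑ˡ d′)) ≤_)
      (trans (List.length-map _ (List.allFin (suc k′))) (List.length-tabulate {n = suc k′} (λ y → y)))
      (degree-≤ C {ι i (w ↑ˡ d′)} survivors (unique ind) member))
      where
      w : Fin (3 + k′)
      w = suc (suc b)

      u : Fin (3 + k′)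
      u = x₀ ↑ˡ suc k′

      w≢u : w ≢ u
      w≢u = end x₀
        where
        end : ∀ (x : Fin 2) → w ≢ x ↑ˡ suc k′
        end 0F ()
        end 1F ()

      survivors : List (Subset (n + m * c))
      survivors = List.map (λ z → row i (padded (couple w (punchIn (punchOut w≢u) z)))) (List.allFin (suc k′))

      member : ∀ {e} → e List.∈ hyperedges C → ι i (w ↑ˡ d′) ∈ e → e List.∈ survivors
      member e∈ w∈ with sound ind e∈
      ... | e∈E , e⊆ with newEdges⁻ e∈E
      ...   | j , p , ∣p∣≡2 , refl with private-unshared {i} {j} (expand-⊆ _ (mask j) w∈)
      ...     | refl with couple-surjective p ∣p∣≡2 (∈-++⁻ˡ p (pos-expand⁻ (padded p) (mask i) (∣mask∣ i) w∈))
      ...       | y , refl with punchOut w≢u ≟ y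
      ...         | yes refl = contradiction
                    (e⊆ (subst (λ x → ι i x ∈ row i (padded (couple w y))) (↑ˡ-assoc x₀)
                      (ι-row i (couple w y) (∈-couple-punchOut w≢u))))
                    gone
      ...         | no  y≢ = subst (λ y → row i (padded (couple w y)) List.∈ survivors) (punchIn-punchOut y≢)
                    (List.∈-map⁺ (λ z → row i (padded (couple w (punchIn (punchOut w≢u) z)))) (List.∈-allFin (punchOut y≢)))

    -- Two elements do not fit into the two ends when one end is missing.
    third-vertex : ∀ {p : Subset (3 + k′)} (x₀ : Fin 2) → ∣ p ∣ ≡ 2 → x₀ ↑ˡ suc k′ ∉ p → ∃[ b ] suc (suc b) ∈ p
    third-vertex {x ∷ y ∷ r} x₀ eq x₀∉ with nonempty? r
    ... | yes (b , b∈) = b , there (there b∈)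
    ... | no empty rewrite Empty-unique empty with x | y | x₀
    ...   | true  | true  | zero     = contradiction here x₀∉
    ...   | true  | true  | suc zero = contradiction (there here) x₀∉
    ...   | true  | false | _        = contradiction (trans (≡.sym (cong suc (∣⊥∣≡0 (suc k′)))) eq) λ ()
    ...   | false | true  | _        = contradiction (trans (≡.sym (cong suc (∣⊥∣≡0 (suc k′)))) eq) λ ()
    ...   | false | false | _        = contradiction (trans (≡.sym (∣⊥∣≡0 (suc k′))) eq) λ ()

    -- A vertex left in the core would lie on an edge, since its degree is positive. That edge
    -- belongs to a copy with a missing end, hence contains some wⱼ, whose degree is then too small
    -- for a core.
    cover⇒stash : ∀ V → All (λ e → Nonempty (e ∩ V)) es → IsVertexStash (2 + k′) G′ (V Vec.++ ⊥)
    cover⇒stash V covers with core-exists (2 + k′) (whole G′ ∖ (V Vec.++ ⊥))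
    ... | C , peels , core = C , (peels , core) , λ (a , a∈) → no-edge (filter-nonempty C (core a a∈))
      where
      ind : Induced newEdges C
      ind = induced-star peels (induced-∖ (V Vec.++ ⊥) (induced-whole G′))

      removed : ∀ {a} → a ∈ V → a ↑ˡ (m * c) ∉ vertices C
      removed a∈ a∈C = ∈-─⁻ ⊤ (V Vec.++ ⊥) (star-⊆ peels a∈C) (∈-++⁺ˡ a∈)

      broken : ∀ i → ∃[ x₀ ] ι i (x₀ ↑ˡ c) ∉ vertices C
      broken i with All.lookup covers (List.∈-lookup i)
      ... | a , a∈ with x∈p∩q⁻ (List.lookup es i) V a∈
      ...   | a∈e , a∈V with pos-surjective (List.lookup es i) (∣edge∣ i) a∈e
      ...     | x₀ , refl = x₀ , λ ∈C → removed a∈V (subst (_∈ vertices C) (ι-edge i x₀) ∈C)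

      no-edge : ∀ {v} → ¬ (∃[ e ] (e List.∈ hyperedges C × v ∈ e))
      no-edge (e , e∈ , _) with sound ind e∈
      ... | e∈E , e⊆ with newEdges⁻ e∈E
      ...   | i , p , ∣p∣≡2 , refl with broken i
      ...     | x₀ , gone with third-vertex x₀ ∣p∣≡2 (λ x₀∈ → gone (e⊆ (subst (λ x → ι i x ∈ row i (padded p)) (↑ˡ-assoc x₀)
                                (ι-row i p x₀∈))))
      ...       | b , b∈ = ℕ.<⇒≱ (sparse ind i x₀ b gone)
                  (core _ (e⊆ (ι-row i p b∈)))

    owner : Fin (n + m * c) → Fin n
    owner a with splitAt n a
    ... | inj₁ b = b
    ... | inj₂ b = pos (List.lookup es (quotient c b)) (∣edge∣ _) zero

    owner-∈ : ∀ i {a} → a ∈ mask i → owner a ∈ List.lookup es i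
    owner-∈ i {a} a∈ with splitAt n a in eq
    ... | inj₁ b = ∈-++⁻ˡ (List.lookup es i) (subst (_∈ mask i) (≡.sym (splitAt⁻¹-↑ˡ {n} eq)) a∈)
    ... | inj₂ b with quotient-block i (∈-++⁻ʳ (List.lookup es i) (subst (_∈ mask i) (≡.sym (splitAt⁻¹-↑ʳ {n} eq)) a∈))
    ...   | refl = pos-∈ (List.lookup es i) (∣edge∣ i) zero

    stash⇒cover : ∀ V → IsVertexStash (2 + k′) G′ V → All (λ e → Nonempty (e ∩ image owner V)) es
    stash⇒cover V (C , (peels , _) , empty) = All.tabulate λ e∈ →
      subst (λ e → Nonempty (e ∩ image owner V)) (≡.sym (Any.lookup-index e∈)) (hit (Any.index e∈))
      where
      ind : Induced newEdges (whole G′ ∖ V)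
      ind = induced-∖ V (induced-whole G′)

      hit : ∀ i → Nonempty (List.lookup es i ∩ image owner V)
      hit i with nonempty? (mask i ∩ V)
      ... | yes (a , a∈) = let a∈m , a∈V = x∈p∩q⁻ (mask i) V a∈ in
                           owner a , x∈p∩q⁺ (owner-∈ i a∈m , ∈-image owner a∈V)
      -- A copy that `V` misses persists, so one of its vertices, here the first, would lie in the
      -- empty core.
      ... | no  disjoint = contradiction
        (_ , persistent (mask i) (mask-dense i) ind
               (λ a∈ → x∈p∧x∉q⇒x∈p─q ∈⊤ (λ a∈V → disjoint (_ , x∈p∩q⁺ (a∈ , a∈V)))) peels
               (pos-∈ (mask i) (∣mask∣ i) zero))
        empty

  -- The reduction map, its encoding and its running time

  reduce : Instance 2 → Instance (2 + d′)
  reduce (G , s) = Construction.G′ (edges G) (uniform G) (simple G) , s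

  module _ (G : Hypergraph 2) where
    open Construction (edges G) (uniform G) (simple G)

    bits-row : ∀ i q → bits (row i q) ≡ rowOf (toℕ i) (m ∸ suc (toℕ i)) q (List.lookup (edges G) i)
    bits-row i (x ∷ y ∷ p) = trans
      (cong bits (trans (expand-++ (x ∷ y ∷ []) p (List.lookup (edges G) i) (block i ⊤) (∣edge∣ i))
                        (cong (expand (x ∷ y ∷ []) (List.lookup (edges G) i) Vec.++_) (expand-block i p))))
      (trans (bits-++ (expand (x ∷ y ∷ []) (List.lookup (edges G) i)) (block i p))
             (cong (bits (expand (x ∷ y ∷ []) (List.lookup (edges G) i)) ++_) (bits-block i p)))

    rows-newEdges : rows newEdges ≡ newRows gadget 0 (edges G)
    rows-newEdges = trans (rows-product row (List.allFin m) gadget)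
      (trans (cong List.concat (List.map-tabulate id (λ i → List.concatMap (λ q → ♯ ∷ bits (row i q)) gadget)))
        (newRows-tabulate gadget (edges G) 0 _ λ i →
          List.concatMap-cong (λ q → cong (♯ ∷_) (bits-row i q)) gadget))

    encode-reduce : ∀ s → newText gadget (List.map binaryDigit (proj₁ (toDigits 2 s))) (edges G)
                          ≡ encode (reduce (G , s))
    encode-reduce s = cong (λ w → List.map binaryDigit (proj₁ (toDigits 2 s)) ++ ♯ ∷ w)
      (trans (≡.sym (List.++-assoc (List.replicate (order G) 𝟙) (times m (Vec.replicate c 𝟙)) _))
        (cong₂ _++_
          (trans (cong (List.replicate (order G) 𝟙 ++_) (times-replicate m c 𝟙)) (≡.sym (replicate-+ (order G))))
          (≡.sym rows-newEdges)))

  runtimeᵖ : Poly 2 (λ l → program-cost (length gadget) c l (newText-bound (length gadget) c l))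
  runtimeᵖ = programᵖ (length gadget) c

  module Input (G : Hypergraph 2) (s : ℕ) where

    digits : List Symbol
    digits = List.map binaryDigit (proj₁ (toDigits 2 s))

    l : ℕ
    l = length (encode (G , s))

    l≡ : l ≡ length digits + suc (order G) + length (rows (edges G))
    l≡ = trans (List.length-++ digits) (trans
      (cong (λ x → length digits + suc x)
        (trans (List.length-++ (List.replicate (order G) 𝟙))
               (cong (_+ length (rows (edges G))) (List.length-replicate (order G)))))
      (≡.sym (+-assoc (length digits) (suc (order G)) _)))

    prefix≤l : length digits + suc (order G) ≤ l
    prefix≤l = ≤-trans (m≤m+n _ _) (≤-reflexive (≡.sym l≡))

    order<l : order G < l
    order<l = ≤-trans (m≤n+m (suc (order G)) (length digits)) prefix≤l

    order≤l : order G ≤ l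
    order≤l = ≤-trans (n≤1+n (order G)) order<l

    rows≤l : length (rows (edges G)) ≤ l
    rows≤l = ≤-trans (m≤n+m _ (length digits + suc (order G))) (≤-reflexive (≡.sym l≡))

    edges≤l : length (edges G) ≤ l
    edges≤l = ≤-trans (length-rows (edges G)) rows≤l

    l-nonZero : NonZero l
    l-nonZero = >-nonZero (≤-trans (s≤s z≤n) order<l)

  reduce-polyTime : PolyTime encode encode reduce
  reduce-polyTime = record
    { machine  = machine (program gadget)
    ; factor   = Poly.coefficient runtimeᵖ
    ; exponent = 2
    ; computes = λ (G , s) →
        let open Input G s
            _ , _ , run = run-program gadget digits (edges G) (digits-notSep (proj₁ (toDigits 2 s))) (uniform G)
              (≤-trans (m≤m+n _ _) prefix≤l) order≤l edges≤l rows≤l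
              (length-newText gadget digits (edges G) prefix≤l order≤l edges≤l)
            t , t≤ , halts = run-machine (program gadget) run
        in t , _ , halts
         , trans (contents-at (blank ∷ []) _) (encode-reduce G s)
         , ≤-trans t≤ (≤-trans (Poly.bound runtimeᵖ l {{l-nonZero}}) (m≤m+n _ _))
    }

  reduce-correct : ∀ I → VERTEX-COVER I ⇔ VERTEX-STASH (2 + k′) (reduce I)
  reduce-correct (G , s) = mk⇔
    (λ (V , covers , V≤s) → V Vec.++ ⊥ , cover⇒stash V covers , ≤-trans (≤-reflexive (∣++⊥∣ V)) V≤s)
    (λ (V , stash , V≤s) → image owner V , stash⇒cover V stash , ≤-trans (∣image∣≤ owner V) V≤s)
    where open Construction (edges G) (uniform G) (simple G)

theorem1 : (k d : ℕ) → 2 ≤ k → 2 ≤ d →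
    ∃[ f ] (IsPolyTimeReduction {2} {d} VERTEX-COVER (VERTEX-STASH k) f
    × (∀ I → proj₂ (f I) ≡ proj₂ I))
theorem1 (suc (suc k′)) (suc (suc d′)) (s≤s (s≤s z≤n)) (s≤s (s≤s z≤n)) =
  reduce , record { polyTime = reduce-polyTime ; correct = reduce-correct } , λ _ → refl
  where open Reduction k′ d′
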